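{- For all integers $k \ge 5$ and $n \ge 2k$, $$rb(\mathcal{T}_n, kK_2) \le 2n+6k-16.$$
   Context: All graphs are undirected, finite and simple. $\mathcal{T}_n$ denotes the class of all plane triangulations of order $n$ (i.e. on $n$ vertices), where a plane triangulation is a plane graph all of whose faces, including the outer face, are bounded by triangles. $kK_2$ denotes a matching of size $k$ (i.e. $k$ pairwise vertex-disjoint edges). Edge-colorings are arbitrary (not necessarily proper), and an edge-coloring "with $m$ colors" is one in which exactly $m$ distinct colors appear on the edges. A subgraph of an edge-colored graph is rainbow if all of its edges have pairwise distinct colors. For a graph $H$, $rb(\mathcal{T}_n, H)$ denotes the minimum number $m$ of colors such that, for every $T_n \in \mathcal{T}_n$ containing $H$ as a subgraph, any edge-coloring of $T_n$ with at least $m$ colors contains a rainbow copy of $H$. -}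

module Defs where

open import Data.Bool using (Bool; true; false; T; T?; not; _∧_)
import Data.Bool.Properties as Bool
open import Data.Fin using (Fin; zero; suc; toℕ; fromℕ<; combine; quotient; _<?_)
open import Data.Fin.Properties
  using (_≟_; all?; any?; toℕ-fromℕ<; toℕ-injective; injective⇒≤; combine-injective)
open import Data.List using (List; []; _∷_; allFin; cartesianProduct; deduplicate; filter; length)
open import Data.List.Membership.Propositional using (_∈_)
open import Data.List.Membership.Propositional.Properties using (∈-allFin; ∈-cartesianProduct⁺)
open import Data.List.Properties using (filter-≐)
open import Data.List.Relation.Unary.Any using (here; there)
open import Data.Nat using (ℕ; zero; suc; _+_; _*_; _≤_; _<_; _≤?_; z≤n; s≤s)
import Data.Nat as ℕ
import Data.Nat.Properties as ℕ
open import Data.Product using (∃; ∃₂; Σ; _×_; _,_; proj₁; proj₂)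
open import Data.Product.Properties using (≡-dec)
open import Data.Sum using (_⊎_; inj₁; inj₂)
open import Data.Unit using (tt)
import Data.Vec.Functional as Vector
open import Function using (_∘_)
open import Function.Definitions using (Injective)
open import Relation.Binary using (Rel; Decidable; DecidableEquality; _⇒_)
open import Relation.Binary.Construct.Closure.ReflexiveTransitive as Star using (Star; ε; _◅_; _◅◅_)
open import Relation.Binary.PropositionalEquality
  using (_≡_; refl; sym; trans; cong; cong₂; subst; _≗_)
open import Relation.Nullary using (Dec; yes; no; ¬_; contradiction; ¬?)
open import Relation.Nullary.Decidable using (⌊_⌋; map′; _×-dec_; _⊎-dec_; _→-dec_; decidable-stable)
open import Level using (0ℓ)

------------------------------------------------------------------------
-- Reachability over a finite type is decidable (Warshall's algorithm)

module Reachability {A : Set} (_≟ᴬ_ : DecidableEquality A)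
                    {R : Rel A 0ℓ} (R? : Decidable R) where

  -- Paths whose interior vertices all lie in the given list.
  Via : List A → Rel A 0ℓ
  Via []       x y = x ≡ y ⊎ R x y
  Via (p ∷ ps) x y = Via ps x y ⊎ (Via ps x p × Via ps p y)

  via? : ∀ ps → Decidable (Via ps)
  via? []       x y = (x ≟ᴬ y) ⊎-dec R? x y
  via? (p ∷ ps) x y = via? ps x y ⊎-dec (via? ps x p ×-dec via? ps p y)

  via⇒star : ∀ ps → Via ps ⇒ Star R
  via⇒star []       (inj₁ refl)    = ε
  via⇒star []       (inj₂ r)       = r ◅ ε
  via⇒star (p ∷ ps) (inj₁ q)       = via⇒star ps q
  via⇒star (p ∷ ps) (inj₂ (q , r)) = via⇒star ps q ◅◅ via⇒star ps r

  via-base : ∀ ps {x y} → x ≡ y ⊎ R x y → Via ps x y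
  via-base []       q = q
  via-base (p ∷ ps) q = inj₁ (via-base ps q)

  via-trans : ∀ ps {x v y} → v ∈ ps → Via ps x v → Via ps v y → Via ps x y
  via-trans (p ∷ ps) (here refl) a b = inj₂ (to a , from b)
    where
    to : ∀ {x} → Via (p ∷ ps) x p → Via ps x p
    to (inj₁ q)       = q
    to (inj₂ (q , _)) = q
    from : ∀ {y} → Via (p ∷ ps) p y → Via ps p y
    from (inj₁ q)       = q
    from (inj₂ (_ , q)) = q
  via-trans (p ∷ ps) (there v∈) (inj₁ a)       (inj₁ b)       = inj₁ (via-trans ps v∈ a b)
  via-trans (p ∷ ps) (there v∈) (inj₁ a)       (inj₂ (b , c)) = inj₂ (via-trans ps v∈ a b , c)
  via-trans (p ∷ ps) (there v∈) (inj₂ (a , b)) (inj₁ c)       = inj₂ (a , via-trans ps v∈ b c)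
  via-trans (p ∷ ps) (there v∈) (inj₂ (a , _)) (inj₂ (_ , d)) = inj₂ (a , d)

  star⇒via : ∀ ps → (∀ x → x ∈ ps) → Star R ⇒ Via ps
  star⇒via ps full ε        = via-base ps (inj₁ refl)
  star⇒via ps full (r ◅ rs) =
    via-trans ps (full _) (via-base ps (inj₂ r)) (star⇒via ps full rs)

  star? : ∀ ps → (∀ x → x ∈ ps) → Decidable (Star R)
  star? ps full x y = map′ (via⇒star ps) (star⇒via ps full) (via? ps x y)

------------------------------------------------------------------------
-- Graphs

record Graph (n : ℕ) : Set where
  field
    adj        : Fin n → Fin n → Bool
    adj-sym    : ∀ u v → adj u v ≡ adj v u
    adj-irrefl : ∀ v → adj v v ≡ false

open Graph public

Adj : ∀ {n} → Graph n → Rel (Fin n) 0ℓ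
Adj G u v = T (adj G u v)

allPairs : ∀ n → List (Fin n × Fin n)
allPairs n = cartesianProduct (allFin n) (allFin n)

-- The oriented edges, i.e. each edge once in either direction.
darts : ∀ {n} → Graph n → List (Fin n × Fin n)
darts {n} G = filter (λ (u , v) → T? (adj G u v)) (allPairs n)

edges : ∀ {n} → Graph n → List (Fin n × Fin n)
edges G = filter (λ (u , v) → u <? v) (darts G)

-- A (not necessarily induced) subgraph of G isomorphic to H.
record Copy {h n} (H : Graph h) (G : Graph n) : Set where
  field
    vertex    : Fin h → Fin n
    injective : Injective _≡_ _≡_ vertex
    preserves : ∀ x y → Adj H x y → Adj G (vertex x) (vertex y)

open Copy public

-- k K₂ : the vertices 2i and 2i+1 (i < k) are joined, and there are no
-- other edges.
_K₂ : ∀ k → Graph (k * 2)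
k K₂ = record
  { adj        = λ x y → ⌊ quotient {k} 2 x ≟ quotient {k} 2 y ⌋ ∧ not ⌊ x ≟ y ⌋
  ; adj-sym    = λ x y → cong₂ (λ a b → a ∧ not b) (≟-comm (quotient {k} 2 x) _) (≟-comm x y)
  ; adj-irrefl = λ x → trans (cong (λ b → ⌊ quotient {k} 2 x ≟ quotient {k} 2 x ⌋ ∧ not b) (≟-diag x))
                             (Bool.∧-zeroʳ _)
  }
  where
  ≟-comm : ∀ {m} (i j : Fin m) → ⌊ i ≟ j ⌋ ≡ ⌊ j ≟ i ⌋
  ≟-comm i j with i ≟ j | j ≟ i
  ... | yes _ | yes _ = refl
  ... | no  _ | no  _ = refl
  ... | yes p | no ¬p = contradiction (sym p) ¬p
  ... | no ¬p | yes p = contradiction (sym p) ¬p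
  ≟-diag : ∀ {m} (i : Fin m) → ⌊ i ≟ i ⌋ ≡ true
  ≟-diag i with i ≟ i
  ... | yes _ = refl
  ... | no ¬p = contradiction refl ¬p

------------------------------------------------------------------------
-- Plane graphs, as combinatorial maps of genus 0
--
-- A drawing of a connected graph on the sphere is recorded up to
-- homeomorphism by its rotation system: rot v w is the neighbour of v
-- that follows w in the cyclic order of the edges around v.  Only the
-- values at adjacent pairs v, w matter.

Rotation : ℕ → Set
Rotation n = Fin n → Fin n → Fin n

record IsRotation {n} (G : Graph n) (rot : Rotation n) : Set where
  field
    closed : ∀ v w → Adj G v w → Adj G v (rot v w)
    -- rot v permutes the neighbours of v in a single cycle.
    cyclic : ∀ v w w′ → Adj G v w → Adj G v w′ → Star (λ x y → rot v x ≡ y) w w′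

-- The next dart along the boundary walk of the face beside a dart; the
-- faces are the orbits of faceStep on the darts.
faceStep : ∀ {n} → Rotation n → Fin n × Fin n → Fin n × Fin n
faceStep rot (u , v) = v , rot v u

SameFace : ∀ {n} → Rotation n → Rel (Fin n × Fin n) 0ℓ
SameFace rot = Star (λ d e → faceStep rot d ≡ e)

sameFace? : ∀ {n} (rot : Rotation n) → Decidable (SameFace rot)
sameFace? {n} rot = Reachability.star? (≡-dec _≟_ _≟_)
  (λ d e → ≡-dec _≟_ _≟_ (faceStep rot d) e)
  (allPairs n) (λ (u , v) → ∈-cartesianProduct⁺ (∈-allFin u) (∈-allFin v))

-- One dart is kept for each face.
faces : ∀ {n} → Graph n → Rotation n → List (Fin n × Fin n)
faces G rot = deduplicate (sameFace? rot) (darts G)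

-- Connected plane graphs (with at least one edge).  Connectedness is no
-- restriction for triangulations, since a face of a disconnected plane
-- graph is not bounded by a single triangle.
record IsPlane {n} (G : Graph n) (rot : Rotation n) : Set where
  field
    isRotation : IsRotation G rot
    connected  : ∀ u v → Star (Adj G) u v
    euler      : n + length (faces G rot) ≡ length (edges G) + 2

-- G has no loops, so a face boundary that closes up after three steps
-- is a triangle.
record IsPlaneTriangulation {n} (G : Graph n) (rot : Rotation n) : Set where
  field
    isPlane    : IsPlane G rot
    triangular : ∀ u v → Adj G u v →
                 faceStep rot (faceStep rot (faceStep rot (u , v))) ≡ (u , v)

𝒯 : ∀ {n} → Graph n → Set
𝒯 G = ∃ (IsPlaneTriangulation G)

------------------------------------------------------------------------
-- Edge-colourings

-- colour is an edge-colouring of G in which exactly c colours appear,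
-- named 0, …, c - 1.  Its values at non-adjacent pairs are irrelevant.
record IsEdgeColouring {n} (G : Graph n) (c : ℕ) (colour : Fin n → Fin n → ℕ) : Set where
  field
    symmetric : ∀ u v → Adj G u v → colour u v ≡ colour v u
    bounded   : ∀ u v → Adj G u v → colour u v < c
    appears   : ∀ (i : Fin c) → ∃₂ λ u v → Adj G u v × colour u v ≡ toℕ i

IsRainbow : ∀ {h n} {H : Graph h} {G : Graph n} → (Fin n → Fin n → ℕ) → Copy H G → Set
IsRainbow {H = H} colour f = ∀ x y x′ y′ → Adj H x y → Adj H x′ y′ →
  colour (vertex f x) (vertex f y) ≡ colour (vertex f x′) (vertex f y′) →
  (x ≡ x′ × y ≡ y′) ⊎ (x ≡ y′ × y ≡ x′)

RainbowCopy : ∀ {h n} → Graph h → Graph n → (Fin n → Fin n → ℕ) → Set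
RainbowCopy H G colour = Σ (Copy H G) (IsRainbow colour)

------------------------------------------------------------------------
-- Rainbow numbers

Forces : ∀ {h} → ℕ → Graph h → ℕ → Set
Forces n H m = (G : Graph n) → 𝒯 G → Copy H G →
  ∀ c → m ≤ c → ∀ colour → IsEdgeColouring G c colour → RainbowCopy H G colour

IsRainbowNumber : ∀ {h} → ℕ → Graph h → ℕ → Set
IsRainbowNumber n H r = Forces n H r × (∀ m → Forces n H m → r ≤ m)

------------------------------------------------------------------------
-- The minimum exists: Forces n H m is decidable, by exhaustive search,
-- and holds as soon as m > n * n.

-- Exhaustive search through functions, in the absence of function
-- extensionality.

Searchable : (A : Set) → Rel A 0ℓ → Set₁
Searchable A _≈_ = (P : A → Set) → (∀ {x y} → x ≈ y → P x → P y) →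
                   (∀ x → Dec (P x)) → Dec (∃ P)

search-Fin : ∀ n → Searchable (Fin n) _≡_
search-Fin n P _ P? = any? P?

search-Bool : Searchable Bool _≡_
search-Bool P _ P? = map′
  (λ { (inj₁ p) → true , p ; (inj₂ p) → false , p })
  (λ { (true , p) → inj₁ p ; (false , p) → inj₂ p })
  (P? true ⊎-dec P? false)

search-Π : ∀ {A _≈_} → (∀ {x} → x ≈ x) → Searchable A _≈_ →
           ∀ n → Searchable (Fin n → A) (λ f g → ∀ i → f i ≈ g i)
search-Π ≈-refl s zero    P resp P? = map′
  (λ p → Vector.[] , p) (λ (f , p) → resp (λ ()) p) (P? Vector.[])
search-Π {A} {_≈_} ≈-refl s (suc n) P resp P? = map′
  (λ (a , f , p) → a Vector.∷ f , p)
  (λ (f , p) → f zero , f ∘ suc , resp (λ { zero → ≈-refl ; (suc i) → ≈-refl }) p)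
  (s (λ a → ∃ λ f → P (a Vector.∷ f))
     (λ a≈b (f , p) → f , resp (λ { zero → a≈b ; (suc i) → ≈-refl }) p)
     (λ a → search-Π ≈-refl s n (λ f → P (a Vector.∷ f))
              (λ f≈g → resp (λ { zero → ≈-refl ; (suc i) → f≈g i }))
              (λ f → P? (a Vector.∷ f))))

_≈₂_ : ∀ {n} {B : Set} → Rel (Fin n → Fin n → B) 0ℓ
f ≈₂ g = ∀ u v → f u v ≡ g u v

search-Matrix : ∀ {B} → Searchable B _≡_ → ∀ n → Searchable (Fin n → Fin n → B) _≈₂_
search-Matrix s n = search-Π (λ _ → refl) (search-Π refl s n) n

_≈ᴳ_ : ∀ {n} → Rel (Graph n) 0ℓ
G ≈ᴳ G′ = adj G ≈₂ adj G′

search-Graph : ∀ n → Searchable (Graph n) _≈ᴳ_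
search-Graph n P resp P? = map′
  (λ (a , (s , i) , p) → mk a s i , p s i)
  (λ (G , p) → adj G , (adj-sym G , adj-irrefl G) , λ s i → resp (λ _ _ → refl) p)
  (search-Matrix search-Bool n Q Q-resp Q?)
  where
  mk : (a : Fin n → Fin n → Bool) → (∀ u v → a u v ≡ a v u) → (∀ v → a v v ≡ false) → Graph n
  mk a s i = record { adj = a ; adj-sym = s ; adj-irrefl = i }
  Valid : (Fin n → Fin n → Bool) → Set
  Valid a = (∀ u v → a u v ≡ a v u) × (∀ v → a v v ≡ false)
  Q : (Fin n → Fin n → Bool) → Set
  Q a = Valid a × (∀ s i → P (mk a s i))
  Q-resp : ∀ {a b} → a ≈₂ b → Q a → Q b
  Q-resp e ((s , i) , p) =
    ( (λ u v → trans (sym (e u v)) (trans (s u v) (e v u)))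
    , (λ v → trans (sym (e v v)) (i v)))
    , λ _ _ → resp e (p s i)
  Q? : ∀ a → Dec (Q a)
  Q? a with all? (λ u → all? λ v → a u v Bool.≟ a v u) ×-dec all? (λ v → a v v Bool.≟ false)
  ... | no ¬v = no (¬v ∘ proj₁)
  ... | yes (s , i) = map′
    (λ p → (s , i) , λ _ _ → resp (λ _ _ → refl) p) (λ (_ , p) → p s i) (P? (mk a s i))

module _ {n} {G G′ : Graph n} (e : G ≈ᴳ G′) where

  adj⇒ : ∀ u v → Adj G u v → Adj G′ u v
  adj⇒ u v = subst T (e u v)

  adj⇐ : ∀ u v → Adj G′ u v → Adj G u v
  adj⇐ u v = subst T (sym (e u v))

  darts-cong : darts G ≡ darts G′
  darts-cong = filter-≐ _ _ ((λ {(u , v)} → adj⇒ u v) , (λ {(u , v)} → adj⇐ u v)) (allPairs n)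

  triangulation-cong : ∀ {rot} → IsPlaneTriangulation G rot → IsPlaneTriangulation G′ rot
  triangulation-cong {rot} t = record
    { isPlane = record
      { isRotation = record
        { closed = λ v w p → adj⇒ _ _ (closed v w (adj⇐ _ _ p))
        ; cyclic = λ v w w′ p q → cyclic v w w′ (adj⇐ _ _ p) (adj⇐ _ _ q)
        }
      ; connected = λ u v → Star.map (adj⇒ _ _) (connected u v)
      ; euler = subst (λ ds → n + length (deduplicate (sameFace? rot) ds)
                              ≡ length (filter (λ (u , v) → u <? v) ds) + 2)
                      darts-cong euler
      }
    ; triangular = λ u v p → triangular u v (adj⇐ _ _ p)
    }
    where
    open IsPlaneTriangulation t
    open IsPlane isPlane
    open IsRotation isRotation

  copy-cong : ∀ {h} {H : Graph h} → Copy H G → Copy H G′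
  copy-cong f = record
    { vertex    = vertex f
    ; injective = injective f
    ; preserves = λ x y p → adj⇒ _ _ (preserves f x y p)
    }

  edgeColouring-cong : ∀ {c colour} → IsEdgeColouring G c colour → IsEdgeColouring G′ c colour
  edgeColouring-cong χ = record
    { symmetric = λ u v p → symmetric u v (adj⇐ _ _ p)
    ; bounded   = λ u v p → bounded u v (adj⇐ _ _ p)
    ; appears   = λ i → let u , v , p , q = appears i in u , v , adj⇒ _ _ p , q
    }
    where open IsEdgeColouring χ

  rainbowCopy-cong : ∀ {h} {H : Graph h} {colour} → RainbowCopy H G colour → RainbowCopy H G′ colour
  rainbowCopy-cong (f , rainbow) = copy-cong f , rainbow

deduplicate-cong : ∀ {A : Set} {R S : Rel A 0ℓ} (R? : Decidable R) (S? : Decidable S) →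
                   R ⇒ S → S ⇒ R → deduplicate R? ≗ deduplicate S?
deduplicate-cong R? S? R⇒S S⇒R []       = refl
deduplicate-cong R? S? R⇒S S⇒R (x ∷ xs) = cong (x ∷_)
  (trans (filter-≐ (¬? ∘ R? x) (¬? ∘ S? x) ((_∘ S⇒R) , (_∘ R⇒S)) (deduplicate R? xs))
         (cong (filter (¬? ∘ S? x)) (deduplicate-cong R? S? R⇒S S⇒R xs)))

faceStep-cong : ∀ {n} {rot rot′ : Rotation n} → rot ≈₂ rot′ → faceStep rot ≗ faceStep rot′
faceStep-cong e (u , v) = cong (v ,_) (e v u)

sameFace-cong : ∀ {n} {rot rot′ : Rotation n} → rot ≈₂ rot′ → SameFace rot ⇒ SameFace rot′
sameFace-cong e = Star.map (λ {d} p → trans (sym (faceStep-cong e d)) p)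

≈₂-sym : ∀ {n} {B : Set} {f g : Fin n → Fin n → B} → f ≈₂ g → g ≈₂ f
≈₂-sym e u v = sym (e u v)

rotation-cong : ∀ {n} {G : Graph n} {rot rot′} → rot ≈₂ rot′ →
                IsPlaneTriangulation G rot → IsPlaneTriangulation G rot′
rotation-cong {n} {G} {rot} {rot′} e t = record
  { isPlane = record
    { isRotation = record
      { closed = λ v w p → subst (Adj G v) (e v w) (closed v w p)
      ; cyclic = λ v w w′ p q → Star.map (λ {x} r → trans (sym (e v x)) r) (cyclic v w w′ p q)
      }
    ; connected = connected
    ; euler = trans (cong (λ fs → n + length fs) (sym faces-cong)) euler
    }
  ; triangular = λ u v p → trans (sym (cubed (u , v))) (triangular u v p)
  }
  where
  open IsPlaneTriangulation t
  open IsPlane isPlane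
  open IsRotation isRotation
  faces-cong : faces G rot ≡ faces G rot′
  faces-cong = deduplicate-cong (sameFace? rot) (sameFace? rot′)
    (sameFace-cong e) (sameFace-cong (≈₂-sym e)) (darts G)
  cubed : ∀ d → faceStep rot (faceStep rot (faceStep rot d))
              ≡ faceStep rot′ (faceStep rot′ (faceStep rot′ d))
  cubed d = trans (cong (faceStep rot ∘ faceStep rot) (faceStep-cong e d))
    (trans (cong (faceStep rot) (faceStep-cong e _)) (faceStep-cong e _))

star-Fin? : ∀ {n} {R : Rel (Fin n) 0ℓ} → Decidable R → Decidable (Star R)
star-Fin? R? = Reachability.star? _≟_ R? (allFin _) ∈-allFin

module _ {n} (G : Graph n) where

  adj? : Decidable (Adj G)
  adj? u v = T? (adj G u v)

  isRotation? : ∀ rot → Dec (IsRotation G rot)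
  isRotation? rot = map′
    (λ (a , b) → record { closed = a ; cyclic = b })
    (λ r → IsRotation.closed r , IsRotation.cyclic r)
    ( (all? λ v → all? λ w → adj? v w →-dec adj? v (rot v w))
    ×-dec (all? λ v → all? λ w → all? λ w′ → adj? v w →-dec (adj? v w′ →-dec
             star-Fin? (λ x y → rot v x ≟ y) w w′)))

  isPlane? : ∀ rot → Dec (IsPlane G rot)
  isPlane? rot = map′
    (λ (a , b , c) → record { isRotation = a ; connected = b ; euler = c })
    (λ r → IsPlane.isRotation r , IsPlane.connected r , IsPlane.euler r)
    (isRotation? rot
    ×-dec ((all? λ u → all? λ v → star-Fin? adj? u v)
    ×-dec (n + length (faces G rot) ℕ.≟ length (edges G) + 2)))

  isPlaneTriangulation? : ∀ rot → Dec (IsPlaneTriangulation G rot)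
  isPlaneTriangulation? rot = map′
    (λ (a , b) → record { isPlane = a ; triangular = b })
    (λ r → IsPlaneTriangulation.isPlane r , IsPlaneTriangulation.triangular r)
    (isPlane? rot
    ×-dec (all? λ u → all? λ v → adj? u v →-dec
             ≡-dec _≟_ _≟_ (faceStep rot (faceStep rot (faceStep rot (u , v)))) (u , v)))

  triangulation? : Dec (𝒯 G)
  triangulation? = search-Matrix (search-Fin n) n (IsPlaneTriangulation G)
    rotation-cong isPlaneTriangulation?

  isEdgeColouring? : ∀ c colour → Dec (IsEdgeColouring G c colour)
  isEdgeColouring? c colour = map′
    (λ (a , b , c) → record { symmetric = a ; bounded = b ; appears = c })
    (λ χ → let open IsEdgeColouring χ in symmetric , bounded , appears)
    ( (all? λ u → all? λ v → adj? u v →-dec (colour u v ℕ.≟ colour v u))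
    ×-dec ((all? λ u → all? λ v → adj? u v →-dec (colour u v ℕ.<? c))
    ×-dec (all? λ i → any? λ u → any? λ v → adj? u v ×-dec (colour u v ℕ.≟ toℕ i))))

  edgeColouring-≤ : ∀ {c colour} → IsEdgeColouring G c colour → c ≤ n * n
  edgeColouring-≤ {c} {colour} χ = injective⇒≤ {f = pair} pair-injective
    where
    open IsEdgeColouring χ
    pair : Fin c → Fin (n * n)
    pair i = let u , v , _ = appears i in combine u v
    pair-injective : Injective _≡_ _≡_ pair
    pair-injective {i} {j} eq =
      let u , v , _ , p = appears i
          x , y , _ , q = appears j
          u≡x , v≡y = combine-injective u v x y eq
      in toℕ-injective (trans (sym p) (trans (cong₂ colour u≡x v≡y) q))

-- Copies and rainbow copies are found together, by searching for a
-- copy that satisfies a further condition on its vertex map.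
module _ {h n} (H : Graph h) (G : Graph n) where

  search-Copy : (P : (Fin h → Fin n) → Set) → (∀ {f g} → f ≗ g → P f → P g) →
                (∀ f → Dec (P f)) → Dec (Σ (Copy H G) (P ∘ vertex))
  search-Copy P resp P? = map′
    (λ (f , i , a , p) → record { vertex = f ; injective = λ {x} {y} → i x y ; preserves = a } , p)
    (λ (f , p) → vertex f , (λ x y → injective f) , preserves f , p)
    (search-Π refl (search-Fin n) h
      (λ f → (∀ x y → f x ≡ f y → x ≡ y) × (∀ x y → Adj H x y → Adj G (f x) (f y)) × P f)
      (λ e (i , a , p) →
          (λ x y q → i x y (trans (e x) (trans q (sym (e y)))))
        , (λ x y q → subst T (cong₂ (adj G) (e x) (e y)) (a x y q))
        , resp e p)
      (λ f → (all? λ x → all? λ y → (f x ≟ f y) →-dec (x ≟ y))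
        ×-dec ((all? λ x → all? λ y → adj? H x y →-dec adj? G (f x) (f y))
        ×-dec P? f)))

  copy? : Dec (Copy H G)
  copy? = map′ proj₁ (_, tt) (search-Copy (λ _ → _) (λ _ _ → tt) (λ _ → yes tt))

  rainbowCopy? : ∀ colour → Dec (RainbowCopy H G colour)
  rainbowCopy? colour = search-Copy
    (λ f → ∀ x y x′ y′ → Adj H x y → Adj H x′ y′ →
           colour (f x) (f y) ≡ colour (f x′) (f y′) → (x ≡ x′ × y ≡ y′) ⊎ (x ≡ y′ × y ≡ x′))
    (λ e r x y x′ y′ p q eq → r x y x′ y′ p q
      (trans (cong₂ colour (e x) (e y)) (trans eq (sym (cong₂ colour (e x′) (e y′))))))
    (λ f → all? λ x → all? λ y → all? λ x′ → all? λ y′ →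
      adj? H x y →-dec (adj? H x′ y′ →-dec
      ((colour (f x) (f y) ℕ.≟ colour (f x′) (f y′)) →-dec
      (((x ≟ x′) ×-dec (y ≟ y′)) ⊎-dec ((x ≟ y′) ×-dec (y ≟ x′))))))

  BadColouring : ℕ → (Fin n → Fin n → ℕ) → Set
  BadColouring c colour = IsEdgeColouring G c colour × ¬ RainbowCopy H G colour

  -- The property depends only on the colours of the edges of G.
  badColouring-cong : ∀ {c colour colour′} → (∀ u v → Adj G u v → colour u v ≡ colour′ u v) →
                      BadColouring c colour → BadColouring c colour′
  badColouring-cong e (χ , ¬r) =
    record
      { symmetric = λ u v p → trans (sym (e u v p)) (trans (symmetric u v p) (e v u (flip p)))
      ; bounded   = λ u v p → subst (_< _) (e u v p) (bounded u v p)
      ; appears   = λ i → let u , v , p , q = appears i in u , v , p , trans (sym (e u v p)) q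
      }
    , λ (f , r) → ¬r (f , λ x y x′ y′ p q eq → r x y x′ y′ p q
        (trans (sym (e _ _ (preserves f x y p))) (trans eq (e _ _ (preserves f x′ y′ q)))))
    where
    open IsEdgeColouring χ
    flip : ∀ {u v} → Adj G u v → Adj G v u
    flip = subst T (adj-sym G _ _)

  badColouring? : ∀ c → Dec (∃ (BadColouring c))
  badColouring? c = map′
    (λ (g , b) → (λ u v → toℕ (g u v)) , b)
    (λ (colour , b@(χ , _)) → clip colour , badColouring-cong
      (λ u v p → sym (clip-≡ colour u v (IsEdgeColouring.bounded χ u v p))) b)
    (search-Matrix (search-Fin (suc c)) n (λ g → BadColouring c (λ u v → toℕ (g u v)))
      (λ e → badColouring-cong (λ u v _ → cong toℕ (e u v)))
      (λ g → isEdgeColouring? G c (λ u v → toℕ (g u v)) ×-dec ¬? (rainbowCopy? (λ u v → toℕ (g u v)))))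
    where
    clip : (Fin n → Fin n → ℕ) → Fin n → Fin n → Fin (suc c)
    clip colour u v = fromℕ< (s≤s (ℕ.m⊓n≤n (colour u v) c))
    clip-≡ : ∀ colour u v → colour u v < c → toℕ (clip colour u v) ≡ colour u v
    clip-≡ colour u v lt = trans (toℕ-fromℕ< _) (ℕ.m≤n⇒m⊓n≡m (ℕ.<⇒≤ lt))

module _ {h} (n : ℕ) (H : Graph h) where

  Counterexample : ℕ → Graph n → Set
  Counterexample m G = 𝒯 G × Copy H G ×
    ∃ λ (i : Fin (suc (n * n))) → m ≤ toℕ i × ∃ (BadColouring H G (toℕ i))

  counterexample? : ∀ m → Dec (∃ (Counterexample m))
  counterexample? m = search-Graph n (Counterexample m)
    (λ {G} {G′} e ((rot , t) , f , i , m≤i , colour , χ , ¬r) →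
      (rot , triangulation-cong {G = G} {G′} e t) , copy-cong {G = G} {G′} e f , i , m≤i , colour
      , edgeColouring-cong {G = G} {G′} e χ
      , ¬r ∘ rainbowCopy-cong {G = G′} {G} (≈₂-sym e) {colour = colour})
    (λ G → triangulation? G ×-dec (copy? H G ×-dec
      any? λ i → (m ≤? toℕ i) ×-dec badColouring? H G (toℕ i)))

  forces? : ∀ m → Dec (Forces n H m)
  forces? m with counterexample? m
  ... | yes (G , t , f , i , m≤i , colour , χ , ¬r) =
    no (λ F → ¬r (F G t f (toℕ i) m≤i colour χ))
  ... | no ¬ce = yes λ G t f c m≤c colour χ →
    decidable-stable (rainbowCopy? H G colour) λ ¬r →
      let c< = s≤s (edgeColouring-≤ G χ)
          eq = sym (toℕ-fromℕ< c<)
      in ¬ce (G , t , f , fromℕ< c< , subst (m ≤_) eq m≤c , colour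
             , subst (λ c → IsEdgeColouring G c colour) eq χ , ¬r)

  forces-large : Forces n H (suc (n * n))
  forces-large G t f c m≤c colour χ = contradiction (edgeColouring-≤ G χ) (ℕ.<⇒≱ m≤c)

least : ∀ {P : ℕ → Set} → (∀ m → Dec (P m)) → ∀ b → P b →
        ∃ λ r → P r × (∀ m → P m → r ≤ m)
least P? zero    p = zero , p , λ _ _ → z≤n
least P? (suc b) p with P? zero
... | yes p₀ = zero , p₀ , λ _ _ → z≤n
... | no ¬p₀ =
  let r , q , min = least (P? ∘ suc) b p
  in suc r , q , λ { zero p₀ → contradiction p₀ ¬p₀ ; (suc m) pₘ → s≤s (min m pₘ) }

abstract
  rainbowNumber : ∀ {h} (n : ℕ) (H : Graph h) → ∃ (IsRainbowNumber n H)
  rainbowNumber n H = least (forces? n H) (suc (n * n)) (forces-large n H)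

rb : ∀ {h} → ℕ → Graph h → ℕ
rb n H = proj₁ (rainbowNumber n H)

rb-isRainbowNumber : ∀ {h} (n : ℕ) (H : Graph h) → IsRainbowNumber n H (rb n H)
rb-isRainbowNumber n H = proj₂ (rainbowNumber n H)

{-# OPTIONS --safe #-}

-- Choose one edge of each colour, and let W be the set of the 2j endpoints of a matching of
-- j < k chosen edges; the matching can be extended as follows.  If no chosen edge misses W, each
-- chosen edge lies inside W or crosses the cut of W.  At most 3|W| − 6 ≤ 6k − 12 edges lie inside W
-- (|W| − 1 if j = 1).
-- A triangular face has at most two crossing edges, so at most 2n − 4 chosen edges cross;
-- with at least 2n + 6k − 16 colours all these bounds are attained, and so both faces uvx
-- and uvy at a matching edge uv have two chosen crossing edges.  Then vx and uy replace uv.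
--
-- The bound 3|W| − 6 on the edges inside W follows from Euler's formula.  Let Y be the
-- other edges, and choose a maximal forest in the graph whose vertices are the faces and
-- whose edges are Y.  No cut of G lies in a dual forest, so G stays connected
-- without the forest, whence Y has at least n − |W| further edges.  Finally every
-- component of the faces joined by Y has at least three boundary edges, all inside W,
-- unless it contains all faces; in that case the same count gives |W| − 1.

module Submission where

open import Defs
open import Data.Bool using (Bool; true; false; T; T?; not; _∧_)
open import Data.Bool.Properties as Bool using (T-∧)
open import Data.Empty using (⊥)
open import Data.Fin using (Fin; zero; suc; toℕ; fromℕ<; quotient; remainder; combine; _<?_)
open import Data.Fin.Properties using (_≟_; any?; <-cmp; <-asym; toℕ-injective; combine-remQuot)
open import Data.List using (List; []; _∷_; _++_; map; filter; length; allFin; deduplicate; lookup)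
open import Data.List.Membership.Propositional using (_∈_; _∉_; find)
open import Data.List.Membership.Propositional.Properties
  using (∈-filter⁺; ∈-filter⁻; ∈-map⁺; ∈-map⁻; ∈-∃++; ∈-lookup; ∈-++⁺ˡ; ∈-++⁺ʳ; ∈-++⁻; ∈-allFin; ∈-cartesianProduct⁺)
open import Data.List.Membership.Propositional.Properties.WithK using (unique∧set⇒bag)
open import Data.List.Properties using (length-++; length-map; length-tabulate; filter-all; map-∘)
open import Data.List.Relation.Binary.BagAndSetEquality using (∼bag⇒↭)
open import Data.List.Relation.Binary.Permutation.Propositional.Properties using (map⁺)
open import Data.List.Relation.Unary.All as All using (All; []; _∷_)
open import Data.List.Relation.Unary.All.Properties using (all-filter; ¬All⇒Any¬; ¬Any⇒All¬)
open import Data.List.Relation.Unary.AllPairs as AllPairs using (AllPairs; []; _∷_)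
import Data.List.Relation.Unary.AllPairs.Properties as AllPairs
open import Data.List.Relation.Unary.Any using (here; there)
import Data.List.Relation.Unary.Any.Properties as Any
open import Data.List.Relation.Unary.Unique.Propositional using (Unique)
import Data.List.Relation.Unary.Unique.Propositional.Properties as Unique
open import Data.Nat using (ℕ; zero; suc; _+_; _*_; _∸_; _≤_; _<_; z≤n; s≤s)
open import Data.Nat.ListAction using (sum)
open import Data.Nat.ListAction.Properties using (sum-↭)
import Data.Nat.Properties as ℕ
open import Data.Nat.Solver using (module +-*-Solver)
open import Algebra.Properties.CommutativeSemigroup ℕ.+-commutativeSemigroup using (interchange)
open import Data.Product using (∃; _×_; _,_; proj₁; proj₂; swap)
open import Data.Product.Properties using (≡-dec)
open import Data.Sum as Sum using (_⊎_; inj₁; inj₂)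
open import Function.Bundles using (Equivalence)
open import Function.Definitions using (Injective)
open import Function using (_∘_; mk⇔; case_of_)
open import Level using (0ℓ)
open import Relation.Binary using (Rel; Decidable; DecidableEquality; tri<; tri≈; tri>)
open import Relation.Binary.Construct.Closure.ReflexiveTransitive using (Star; ε; _◅_; _◅◅_)
open import Relation.Binary.PropositionalEquality
  using (_≡_; _≢_; refl; sym; trans; cong; cong₂; subst; subst₂; module ≡-Reasoning)
open import Relation.Nullary using (Dec; yes; no; ¬_; contradiction; ¬?)
open import Relation.Nullary.Decidable
  using (does; dec-true; dec-false; decidable-stable; toWitness; toWitnessFalse; ⌊_⌋; _×-dec_; _⊎-dec_)
import Relation.Unary as Unary

private module _ {n : ℕ} where
  open import Data.List.Membership.DecPropositional (_≟_ {n}) using (_∈?_) public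

private variable
  A B : Set

-- Duplicate-free lists, indicators and finite sums.

module _ (_≟ᴬ_ : DecidableEquality A) where

  unique-⊆⇒length-≤ : ∀ {xs ys : List A} → Unique xs → (∀ {x} → x ∈ xs → x ∈ ys) →
                      length xs ≤ length ys
  unique-⊆⇒length-≤ [] _ = z≤n
  unique-⊆⇒length-≤ {x ∷ xs} (x∉ ∷ uniq) sub with as , bs , refl ← ∈-∃++ (sub (here refl)) =
    ℕ.≤-trans (s≤s (unique-⊆⇒length-≤ uniq sub′))
      (ℕ.≤-reflexive (trans (cong suc (length-++ as)) (trans (sym (ℕ.+-suc (length as) _)) (sym (length-++ as)))))
    where
    sub′ : ∀ {y} → y ∈ xs → y ∈ as ++ bs
    sub′ y∈ with ∈-++⁻ as (sub (there y∈))
    ... | inj₁ p = ∈-++⁺ˡ p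
    ... | inj₂ (here refl) = contradiction refl (All.lookup x∉ y∈)
    ... | inj₂ (there p) = ∈-++⁺ʳ as p

unique-map : ∀ (f : A → B) {xs} → (∀ {x y} → x ∈ xs → y ∈ xs → f x ≡ f y → x ≡ y) →
             Unique xs → Unique (map f xs)
unique-map f inj [] = []
unique-map f {x ∷ xs} inj (x∉ ∷ uniq) =
  All.tabulate (λ y∈ eq → let z , z∈ , y≡ = ∈-map⁻ f y∈ in
    All.lookup x∉ z∈ (inj (here refl) (there z∈) (trans eq y≡)))
  ∷ unique-map f (λ p q → inj (there p) (there q)) uniq

indicator : ∀ {P : Set} → Dec P → ℕ
indicator (yes _) = 1
indicator (no  _) = 0

indicator-yes : ∀ {P : Set} (P? : Dec P) → P → indicator P? ≡ 1
indicator-yes (yes _) p = refl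
indicator-yes (no ¬p) p = contradiction p ¬p

indicator-no : ∀ {P : Set} (P? : Dec P) → ¬ P → indicator P? ≡ 0
indicator-no (yes p) ¬p = contradiction p ¬p
indicator-no (no _)  ¬p = refl

indicator-⇔ : ∀ {P Q : Set} (P? : Dec P) (Q? : Dec Q) → (P → Q) → (Q → P) → indicator P? ≡ indicator Q?
indicator-⇔ (yes p) Q? f g = sym (indicator-yes Q? (f p))
indicator-⇔ (no ¬p) Q? f g = sym (indicator-no Q? (¬p ∘ g))

indicator-⊎ : ∀ {P Q R : Set} (P? : Dec P) (Q? : Dec Q) (R? : Dec R) → (P → Q ⊎ R) →
              indicator P? ≤ indicator Q? + indicator R?
indicator-⊎ (no _)  Q? R? f = z≤n
indicator-⊎ (yes p) Q? R? f with f p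
... | inj₁ q rewrite indicator-yes Q? q = s≤s z≤n
... | inj₂ r rewrite indicator-yes R? r = ℕ.m≤n+m 1 (indicator Q?)

∑ : List A → (A → ℕ) → ℕ
∑ xs f = sum (map f xs)

∑-+ : ∀ (xs : List A) f g → ∑ xs (λ x → f x + g x) ≡ ∑ xs f + ∑ xs g
∑-+ [] f g = refl
∑-+ (x ∷ xs) f g = trans (cong (f x + g x +_) (∑-+ xs f g)) (interchange (f x) (g x) (∑ xs f) (∑ xs g))

∑-mono : ∀ (xs : List A) {f g} → (∀ {x} → x ∈ xs → f x ≤ g x) → ∑ xs f ≤ ∑ xs g
∑-mono []       le = z≤n
∑-mono (x ∷ xs) le = ℕ.+-mono-≤ (le (here refl)) (∑-mono xs (le ∘ there))

∑-mono-< : ∀ {xs : List A} {f g} → (∀ {x} → x ∈ xs → f x ≤ g x) →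
           ∀ {y} → y ∈ xs → f y < g y → ∑ xs f < ∑ xs g
∑-mono-< {xs = x ∷ xs} le (here refl) lt = ℕ.+-mono-<-≤ lt (∑-mono xs (le ∘ there))
∑-mono-< {xs = x ∷ xs} le (there y∈)  lt = ℕ.+-mono-≤-< (le (here refl)) (∑-mono-< (le ∘ there) y∈ lt)

∑-cong : ∀ (xs : List A) {f g} → (∀ {x} → x ∈ xs → f x ≡ g x) → ∑ xs f ≡ ∑ xs g
∑-cong []       eq = refl
∑-cong (x ∷ xs) eq = cong₂ _+_ (eq (here refl)) (∑-cong xs (eq ∘ there))

∑-const : ∀ (xs : List A) c → ∑ xs (λ _ → c) ≡ length xs * c
∑-const []       c = refl
∑-const (x ∷ xs) c = cong (c +_) (∑-const xs c)

module _ {P : A → Set} (P? : Unary.Decidable P) where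

  ∑-filter : ∀ xs f → ∑ (filter P? xs) f ≡ ∑ xs (λ x → indicator (P? x) * f x)
  ∑-filter [] f = refl
  ∑-filter (x ∷ xs) f with P? x
  ... | yes _ = cong₂ _+_ (sym (ℕ.+-identityʳ (f x))) (∑-filter xs f)
  ... | no  _ = ∑-filter xs f

  length-filter-split : ∀ xs → length xs ≡ length (filter P? xs) + length (filter (¬? ∘ P?) xs)
  length-filter-split [] = refl
  length-filter-split (x ∷ xs) with P? x
  ... | yes _ = cong suc (length-filter-split xs)
  ... | no  _ = trans (cong suc (length-filter-split xs)) (sym (ℕ.+-suc _ _))

  length-filter-∑ : ∀ xs → length (filter P? xs) ≡ ∑ xs (indicator ∘ P?)
  length-filter-∑ [] = refl
  length-filter-∑ (x ∷ xs) with P? x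
  ... | yes _ = cong suc (length-filter-∑ xs)
  ... | no  _ = length-filter-∑ xs

-- Duplicate-free lists with the same elements are permutations of each other; here these are `xs`
-- and its image under `σ`.
∑-reindex : ∀ {xs : List A} → Unique xs → (σ τ : A → A) →
            (∀ {x} → x ∈ xs → σ x ∈ xs) → (∀ {x} → x ∈ xs → τ x ∈ xs) →
            (∀ {x} → x ∈ xs → τ (σ x) ≡ x) → (∀ {x} → x ∈ xs → σ (τ x) ≡ x) →
            ∀ f → ∑ xs (f ∘ σ) ≡ ∑ xs f
∑-reindex {xs = xs} uniq σ τ σ∈ τ∈ τσ στ f =
  trans (cong sum (map-∘ xs)) (sum-↭ (map⁺ f (∼bag⇒↭ (unique∧set⇒bag
    (unique-map σ (λ p q eq → trans (sym (τσ p)) (trans (cong τ eq) (τσ q))) uniq) uniq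
    (mk⇔ (λ p → let z , z∈ , eq = ∈-map⁻ σ p in subst (_∈ xs) (sym eq) (σ∈ z∈))
         (λ p → subst (_∈ map σ xs) (στ p) (∈-map⁺ σ (τ∈ p))))))))

-- A partition of a type, given by naming a representative of each class;
-- reps need not list all the classes.
record Labelling (A : Set) : Set where
  field
    label  : A → A
    reps   : List A
    unique : Unique reps
    fixed  : ∀ {l} → l ∈ reps → label l ≡ l

open Labelling

-- Merging the classes of a partition.

module _ (_≟ᴬ_ : DecidableEquality A) where

  relabel : A → A → A → A
  relabel a b x with x ≟ᴬ a
  ... | yes _ = b
  ... | no  _ = x

  relabel-≡ : ∀ a b → relabel a b a ≡ relabel a b b
  relabel-≡ a b with a ≟ᴬ a | b ≟ᴬ a
  ... | yes _ | yes _ = refl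
  ... | yes _ | no  _ = refl
  ... | no ¬p | _     = contradiction refl ¬p

  relabel-≢ : ∀ a b {x} → x ≢ a → relabel a b x ≡ x
  relabel-≢ a b {x} ne with x ≟ᴬ a
  ... | yes p = contradiction p ne
  ... | no  _ = refl

  length-filter-≢ : ∀ a {xs} → Unique xs → length xs ≤ suc (length (filter (λ x → ¬? (x ≟ᴬ a)) xs))
  length-filter-≢ a {xs} uniq = unique-⊆⇒length-≤ _≟ᴬ_ {ys = a ∷ _} uniq λ {x} x∈ → sub x x∈
    where
    sub : ∀ x → x ∈ xs → x ∈ a ∷ filter (λ x → ¬? (x ≟ᴬ a)) xs
    sub x x∈ with x ≟ᴬ a
    ... | yes p = here p
    ... | no ¬p = there (∈-filter⁺ (λ x → ¬? (x ≟ᴬ a)) x∈ ¬p)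

  -- The class of `a` is renamed to that of `b`, so at most one name leaves `reps`, namely the old
  -- label of `a`.
  merge : A → A → Labelling A → Labelling A
  merge a b L = record
    { label  = relabel (label L a) (label L b) ∘ label L
    ; reps   = filter (λ x → ¬? (x ≟ᴬ label L a)) (reps L)
    ; unique = Unique.filter⁺ _ (unique L)
    ; fixed  = λ {l} l∈ → let l∈′ , ne = ∈-filter⁻ (λ x → ¬? (x ≟ᴬ label L a)) {xs = reps L} l∈
                          in trans (relabel-≢ _ _ (ne ∘ trans (sym (fixed L l∈′)))) (fixed L l∈′)
    }

  merge-identifies : ∀ a b L → label (merge a b L) a ≡ label (merge a b L) b
  merge-identifies a b L = relabel-≡ (label L a) (label L b)

  merge-coarser : ∀ a b L {x y} → label L x ≡ label L y → label (merge a b L) x ≡ label (merge a b L) y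
  merge-coarser a b L = cong (relabel _ _)

  merge-reps : ∀ a b L → length (reps L) ≤ suc (length (reps (merge a b L)))
  merge-reps a b L = length-filter-≢ (label L a) (unique L)

  -- Each pair costs at most one representative: a graph with N vertices and m edges has at least N
  -- - m components.
  mergeAll : ∀ (es : List (A × A)) (L : Labelling A) → ∃ λ L′ →
             (length (reps L) ≤ length es + length (reps L′)) ×
             (∀ {x y} → label L x ≡ label L y → label L′ x ≡ label L′ y) ×
             (∀ {x y} → (x , y) ∈ es → label L′ x ≡ label L′ y)
  mergeAll [] L = L , ℕ.≤-refl , (λ eq → eq) , λ ()
  mergeAll ((a , b) ∷ es) L =
    let L′ , len , coarse , ident = mergeAll es (merge a b L)
    in L′ , ℕ.≤-trans (merge-reps a b L) (s≤s len) , coarse ∘ merge-coarser a b L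
       , λ { (here refl) → coarse (merge-identifies a b L) ; (there p) → ident p }

deduplicate-separated : ∀ {R : Rel A 0ℓ} (R? : Decidable R) xs →
                        AllPairs (λ x y → ¬ R x y) (deduplicate R? xs)
deduplicate-separated R? [] = []
deduplicate-separated R? (x ∷ xs) =
  all-filter (¬? ∘ R? x) (deduplicate R? xs) ∷ AllPairs.filter⁺ _ (deduplicate-separated R? xs)

-- Darts and edges of a graph.

Dart : ℕ → Set
Dart n = Fin n × Fin n

_≟ᴰ_ : ∀ {n} → DecidableEquality (Dart n)
_≟ᴰ_ = ≡-dec _≟_ _≟_

allPairs-unique : ∀ n → Unique (allPairs n)
allPairs-unique n = Unique.cartesianProduct⁺ (Unique.allFin⁺ n) (Unique.allFin⁺ n)

module GraphLemmas {n} (G : Graph n) where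

  IsDart : Dart n → Set
  IsDart (u , v) = Adj G u v

  isDart? : ∀ d → Dec (IsDart d)
  isDart? (u , v) = T? (adj G u v)

  adj-swap : ∀ {u v} → Adj G u v → Adj G v u
  adj-swap {u} {v} = subst T (adj-sym G u v)

  adj-≢ : ∀ {u v} → Adj G u v → u ≢ v
  adj-≢ {u} p refl = subst T (adj-irrefl G u) p

  ∈-darts⁺ : ∀ {u v} → Adj G u v → (u , v) ∈ darts G
  ∈-darts⁺ {u} {v} = ∈-filter⁺ _ (∈-cartesianProduct⁺ (∈-allFin u) (∈-allFin v))

  ∈-darts⁻ : ∀ {d} → d ∈ darts G → IsDart d
  ∈-darts⁻ = proj₂ ∘ ∈-filter⁻ (λ (u , v) → T? (adj G u v)) {xs = allPairs n}

  darts-unique : Unique (darts G)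
  darts-unique = Unique.filter⁺ _ (allPairs-unique n)

  ∈-edges⁻ : ∀ {d} → d ∈ edges G → IsDart d
  ∈-edges⁻ = ∈-darts⁻ ∘ proj₁ ∘ ∈-filter⁻ (λ (u , v) → u <? v) {xs = darts G}

  ∈-edges⁺ : ∀ {u v} → Adj G u v → (u , v) ∈ edges G ⊎ (v , u) ∈ edges G
  ∈-edges⁺ {u} {v} p with <-cmp u v
  ... | tri< u<v _ _ = inj₁ (∈-filter⁺ _ (∈-darts⁺ p) u<v)
  ... | tri≈ _ u≡v _ = contradiction u≡v (adj-≢ p)
  ... | tri> _ _ v<u = inj₂ (∈-filter⁺ _ (∈-darts⁺ (adj-swap p)) v<u)

  ∑-swap : ∀ f → ∑ (darts G) (f ∘ swap) ≡ ∑ (darts G) f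
  ∑-swap = ∑-reindex darts-unique swap swap sw sw (λ _ → refl) (λ _ → refl)
    where
    sw : ∀ {d} → d ∈ darts G → swap d ∈ darts G
    sw = ∈-darts⁺ ∘ adj-swap ∘ ∈-darts⁻

  handshake : ∀ f → (∀ d → f (swap d) ≡ f d) → ∑ (darts G) f ≡ 2 * ∑ (edges G) f
  handshake f sym-f = begin
    ∑ (darts G) f
      ≡⟨ ∑-cong (darts G) (λ {d} → split d ∘ ∈-darts⁻) ⟩
    ∑ (darts G) (λ d → g d + g (swap d))
      ≡⟨ ∑-+ (darts G) g (g ∘ swap) ⟩
    ∑ (darts G) g + ∑ (darts G) (g ∘ swap)
      ≡⟨ cong (∑ (darts G) g +_) (trans (∑-swap g) (sym (ℕ.+-identityʳ _))) ⟩
    2 * ∑ (darts G) g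
      ≡⟨ cong (2 *_) (sym (∑-filter (λ (u , v) → u <? v) (darts G) f)) ⟩
    2 * ∑ (edges G) f ∎
    where
    open ≡-Reasoning
    -- `g` keeps the darts with the smaller endpoint first, that is, those listed in `edges G`.
    g : Dart n → ℕ
    g d@(u , v) = indicator (u <? v) * f d
    split : ∀ d → IsDart d → f d ≡ g d + g (swap d)
    split (u , v) p with u <? v | v <? u
    ... | yes u<v | yes v<u = contradiction v<u (<-asym u<v)
    ... | yes _   | no _    = sym (trans (ℕ.+-identityʳ _) (ℕ.+-identityʳ _))
    ... | no _    | yes _   = sym (trans (ℕ.+-identityʳ _) (sym-f (u , v)))
    ... | no u≮v  | no v≮u with <-cmp u v
    ...   | tri< u<v _ _ = contradiction u<v u≮v
    ...   | tri≈ _ u≡v _ = contradiction u≡v (adj-≢ p)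
    ...   | tri> _ _ v<u = contradiction v<u v≮u

-- Faces of a triangulation and forests in its dual graph.

module TriangulationLemmas {n} {G : Graph n} {rot} (t : IsPlaneTriangulation G rot) where

  open GraphLemmas G
  open IsPlaneTriangulation t
  open IsPlane isPlane
  open IsRotation isRotation

  step : Dart n → Dart n
  step = faceStep rot

  step-dart : ∀ {d} → IsDart d → IsDart (step d)
  step-dart {u , v} p = closed v u (adj-swap p)

  step³ : ∀ {d} → IsDart d → step (step (step d)) ≡ d
  step³ {u , v} = triangular u v

  -- All faces are triangles, so the face step permutes the darts, with inverse `step ∘ step`.
  ∑-step : ∀ f → ∑ (darts G) (f ∘ step) ≡ ∑ (darts G) f
  ∑-step = ∑-reindex darts-unique step (step ∘ step)
    (st ∘ ∈-darts⁻) (st ∘ step-dart ∘ ∈-darts⁻) (step³ ∘ ∈-darts⁻) (step³ ∘ ∈-darts⁻)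
    where
    st : ∀ {d} → IsDart d → step d ∈ darts G
    st {d} p = ∈-darts⁺ (step-dart {d} p)

  -- Constancy along face boundaries: such a function is a labelling of the faces, evaluated at
  -- their darts.
  StepInvariant : (Dart n → Dart n) → Set
  StepInvariant ψ = ∀ {d} → IsDart d → ψ (step d) ≡ ψ d

  -- A union K of faces has as many boundary darts leaving the vertex set U as entering
  -- it, and so e cannot be the only edge that crosses both ∂K and the cut of U.
  no-single-crossing :
    ∀ {ψ} → StepInvariant ψ → ∀ (U : Fin n → Bool) {a b} → Adj G a b →
    U a ≡ true → U b ≡ false → ψ (a , b) ≢ ψ (b , a) →
    ¬ (∀ {u v} → Adj G u v → U u ≡ true → U v ≡ false → (u , v) ≢ (a , b) → ψ (u , v) ≡ ψ (v , u))
  no-single-crossing {ψ} ψ-step U {a} {b} ab Ua Ub ne others =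
    ℕ.<-irrefl (trans (∑-swap entering) (sym balanced))
      (∑-mono-< (λ {d} → le d ∘ ∈-darts⁻) (∈-darts⁺ ab) lt)
    where
    D = darts G
    [_] : Bool → ℕ
    [ true  ] = 1
    [ false ] = 0
    K : Dart n → ℕ
    K d = indicator (ψ d ≟ᴰ ψ (a , b))
    leaving entering source : Dart n → ℕ
    leaving  (u , v) = K (u , v) * [ U u ∧ not (U v) ]
    entering (u , v) = K (u , v) * [ U v ∧ not (U u) ]
    source   (u , v) = K (u , v) * [ U u ]
    -- The end of a dart is the start of the next dart of its face. Summed over all darts, `source`
    -- and `source ∘ step` cancel, and `leaving` balances `entering`.
    pointwise : ∀ {d} → d ∈ D → source d + entering d ≡ source (step d) + leaving d
    pointwise {u , v} d∈ = trans (sym (ℕ.*-distribˡ-+ (K (u , v)) _ _))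
      (trans (cong (K (u , v) *_) (bool (U u) (U v)))
      (trans (ℕ.*-distribˡ-+ (K (u , v)) _ _)
      (cong (λ x → indicator (x ≟ᴰ ψ (a , b)) * [ U v ] + leaving (u , v)) (sym (ψ-step (∈-darts⁻ d∈))))))
      where
      bool : ∀ x y → [ x ] + [ y ∧ not x ] ≡ [ y ] + [ x ∧ not y ]
      bool true  true  = refl
      bool true  false = refl
      bool false true  = refl
      bool false false = refl
    balanced : ∑ D leaving ≡ ∑ D entering
    balanced = sym (ℕ.+-cancelˡ-≡ (∑ D source) _ _ (trans (sym (∑-+ D source entering))
      (trans (∑-cong D pointwise)
      (trans (∑-+ D (source ∘ step) leaving) (cong (_+ ∑ D leaving) (∑-step source))))))
    -- A crossing edge other than `(a , b)` has both sides in K or neither. The dart `(a , b)`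
    -- leaves U within K while its reverse lies outside K, which breaks the balance.
    le : ∀ d → IsDart d → entering (swap d) ≤ leaving d
    le (u , v) p with U u in Uu | U v in Uv
    ... | true  | true  = ℕ.≤-reflexive (trans (ℕ.*-zeroʳ (K (v , u))) (sym (ℕ.*-zeroʳ (K (u , v)))))
    ... | false | true  = ℕ.≤-reflexive (trans (ℕ.*-zeroʳ (K (v , u))) (sym (ℕ.*-zeroʳ (K (u , v)))))
    ... | false | false = ℕ.≤-reflexive (trans (ℕ.*-zeroʳ (K (v , u))) (sym (ℕ.*-zeroʳ (K (u , v)))))
    ... | true  | false with (u , v) ≟ᴰ (a , b)
    ...   | yes refl = subst (_≤ K (a , b) * 1)
      (sym (cong (_* 1) (indicator-no (ψ (b , a) ≟ᴰ ψ (a , b)) (ne ∘ sym)))) z≤n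
    ...   | no uv≢ab =
      ℕ.≤-reflexive (cong (λ x → indicator (x ≟ᴰ ψ (a , b)) * 1) (sym (others p Uu Uv uv≢ab)))
    lt : entering (b , a) < leaving (a , b)
    lt = subst₂ _<_
      (sym (cong (_* [ U a ∧ not (U b) ]) (indicator-no (ψ (b , a) ≟ᴰ ψ (a , b)) (ne ∘ sym))))
      (sym (cong₂ _*_ (indicator-yes (ψ (a , b) ≟ᴰ ψ (a , b)) refl)
                      (cong₂ (λ x y → [ x ∧ not y ]) Ua Ub)))
      (s≤s z≤n)

  -- Turns membership in a face, a reachability relation, into equality of labels. The argument
  -- `default` makes the function total, at pairs in none of the listed faces.
  firstInFace : Dart n → List (Dart n) → Dart n → Dart n
  firstInFace default []       d = default
  firstInFace default (f ∷ fs) d with sameFace? rot f d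
  ... | yes _ = f
  ... | no  _ = firstInFace default fs d

  firstInFace-step : ∀ default fs → StepInvariant (firstInFace default fs)
  firstInFace-step default [] p = refl
  firstInFace-step default (f ∷ fs) {d} p with sameFace? rot f (step d) | sameFace? rot f d
  ... | yes _ | yes _ = refl
  ... | no  _ | no  _ = firstInFace-step default fs {d} p
  -- Two further steps lead from `step d` back to `d`.
  ... | yes q | no ¬q = contradiction (q ◅◅ refl ◅ step³ {d} p ◅ ε) ¬q
  ... | no ¬q | yes q = contradiction (q ◅◅ refl ◅ ε) ¬q

  firstInFace-fixed : ∀ default {fs} → AllPairs (λ f g → ¬ SameFace rot f g) fs →
                      ∀ {l} → l ∈ fs → firstInFace default fs l ≡ l
  firstInFace-fixed default {f ∷ fs} (_ ∷ _) (here refl) with sameFace? rot f f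
  ... | yes _ = refl
  ... | no ¬q = contradiction ε ¬q
  firstInFace-fixed default {f ∷ fs} (f≁ ∷ sep) {l} (there l∈) with sameFace? rot f l
  ... | yes q = contradiction q (All.lookup f≁ l∈)
  ... | no _ = firstInFace-fixed default sep l∈

  faces-separated : AllPairs (λ f g → ¬ SameFace rot f g) (faces G rot)
  faces-separated = deduplicate-separated (sameFace? rot) (darts G)

  faceLabelling : Dart n → Labelling (Dart n)
  faceLabelling default = record
    { label  = firstInFace default (faces G rot)
    ; reps   = faces G rot
    ; unique = AllPairs.map (λ { ¬q refl → ¬q ε }) faces-separated
    ; fixed  = firstInFace-fixed default faces-separated
    }

  -- The edges of forest join the faces without closing a cycle of the dual graph, and
  -- classes names the connected components of the dual graph with edge set Y.
  record DualForest (Y : List (Dart n)) : Set where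
    field
      forest rest : List (Dart n)
      forest⊆Y    : ∀ {e} → e ∈ forest → e ∈ Y
      covers      : ∀ {e} → e ∈ Y → e ∈ forest ⊎ e ∈ rest
      sizes       : length forest + length rest ≡ length Y
      classes     : Labelling (Dart n)
      invariant   : StepInvariant (label classes)
      joined      : ∀ {u v} → (u , v) ∈ Y → label classes (u , v) ≡ label classes (v , u)
      reps-darts  : ∀ {l} → l ∈ reps classes → IsDart l
      classes-≥   : length (faces G rot) ≤ length forest + length (reps classes)
      no-cut      : ∀ (U : Fin n → Bool) →
                    (∀ {u v} → Adj G u v → U u ≡ true → U v ≡ false →
                      (u , v) ∈ forest ⊎ (v , u) ∈ forest) →
                    ∀ {u v} → Adj G u v → U u ≡ true → U v ≢ false

  -- Greedy as in Kruskal's algorithm: an edge enters the forest exactly when the faces on its two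
  -- sides are still in different classes, which are then merged.
  dualForest : Dart n → ∀ Y → (∀ {e} → e ∈ Y → IsDart e) → DualForest Y
  dualForest default [] _ = record
    { forest     = []
    ; rest       = []
    ; forest⊆Y   = λ ()
    ; covers     = λ ()
    ; sizes      = refl
    ; classes    = faceLabelling default
    ; invariant  = λ {d} → firstInFace-step default (faces G rot) {d}
    ; joined     = λ ()
    ; reps-darts = λ l∈ → ∈-darts⁻ (Any.deduplicate⁻ (sameFace? rot) l∈)
    ; classes-≥  = ℕ.≤-refl
    ; no-cut     = λ U crossing p Uu Uv → case crossing p Uu Uv of λ { (inj₁ ()) ; (inj₂ ()) }
    }
  dualForest default ((a , b) ∷ Y) Y-darts
    with rec ← dualForest default Y (Y-darts ∘ there)
    with label (DualForest.classes rec) (a , b) ≟ᴰ label (DualForest.classes rec) (b , a)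
  ... | yes eq = record
    { forest     = R.forest
    ; rest       = (a , b) ∷ R.rest
    ; forest⊆Y   = there ∘ R.forest⊆Y
    ; covers     = λ { (here refl) → inj₂ (here refl) ; (there p) → Sum.map₂ there (R.covers p) }
    ; sizes      = trans (ℕ.+-suc (length R.forest) _) (cong suc R.sizes)
    ; classes    = R.classes
    ; invariant  = λ {d} → R.invariant {d}
    ; joined     = λ { (here refl) → eq ; (there p) → R.joined p }
    ; reps-darts = R.reps-darts
    ; classes-≥  = R.classes-≥
    ; no-cut     = R.no-cut
    }
    where module R = DualForest rec
  ... | no ne = record
    { forest     = (a , b) ∷ R.forest
    ; rest       = R.rest
    ; forest⊆Y   = λ { (here refl) → here refl ; (there p) → there (R.forest⊆Y p) }
    ; covers     = λ { (here refl) → inj₁ (here refl) ; (there p) → Sum.map₁ there (R.covers p) }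
    ; sizes      = cong suc R.sizes
    ; classes    = merged
    ; invariant  = λ {d} p → merge-coarser _≟ᴰ_ (a , b) (b , a) R.classes (R.invariant {d} p)
    ; joined     = λ { (here refl) → merge-identifies _≟ᴰ_ (a , b) (b , a) R.classes
                     ; (there p) → merge-coarser _≟ᴰ_ (a , b) (b , a) R.classes (R.joined p) }
    ; reps-darts = λ l∈ → R.reps-darts (proj₁ (∈-filter⁻ (λ x → ¬? (x ≟ᴰ label R.classes (a , b))) l∈))
    ; classes-≥  = ℕ.≤-trans R.classes-≥ (ℕ.≤-trans
                     (ℕ.+-monoʳ-≤ (length R.forest) (merge-reps _≟ᴰ_ (a , b) (b , a) R.classes))
                     (ℕ.≤-reflexive (ℕ.+-suc (length R.forest) _)))
    ; no-cut     = no-cut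
    }
    where
    module R = DualForest rec
    merged : Labelling (Dart n)
    merged = merge _≟ᴰ_ (a , b) (b , a) R.classes
    ab : Adj G a b
    ab = Y-darts (here refl)
    module _ (U : Fin n → Bool)
             (crossing : ∀ {u v} → Adj G u v → U u ≡ true → U v ≡ false →
               (u , v) ∈ (a , b) ∷ R.forest ⊎ (v , u) ∈ (a , b) ∷ R.forest) where
      true≢false : ∀ {x} → x ≡ true → x ≢ false
      true≢false refl ()
      others : ∀ {u v} → Adj G u v → U u ≡ true → U v ≡ false → (u , v) ≢ (a , b) → (u , v) ≢ (b , a) →
               (u , v) ∈ R.forest ⊎ (v , u) ∈ R.forest
      others p Uu Uv ≢ab ≢ba with crossing p Uu Uv
      ... | inj₁ (here eq)  = contradiction eq ≢ab
      ... | inj₁ (there q)  = inj₁ q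
      ... | inj₂ (here eq)  = contradiction (cong swap eq) ≢ba
      ... | inj₂ (there q)  = inj₂ q
      same : ∀ {u v} → (u , v) ∈ R.forest ⊎ (v , u) ∈ R.forest →
             label R.classes (u , v) ≡ label R.classes (v , u)
      same (inj₁ q) = R.joined (R.forest⊆Y q)
      same (inj₂ q) = sym (R.joined (R.forest⊆Y q))
      no-cut : ∀ {u v} → Adj G u v → U u ≡ true → U v ≢ false
      -- If the new edge crosses the cut, the other crossing edges lie in the earlier forest and
      -- have one class on both sides, which `no-single-crossing` excludes. If not, the whole cut
      -- lies in the earlier forest.
      no-cut {u} {v} p Uu Uv with U a in Ua | U b in Ub
      ... | true | false = no-single-crossing (λ {d} → R.invariant {d}) U ab Ua Ub ne
        λ q Ux Uy ≢ab → same (others q Ux Uy ≢ab λ { refl → true≢false Ux Ub })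
      ... | false | true = no-single-crossing (λ {d} → R.invariant {d}) U (adj-swap ab) Ub Ua (ne ∘ sym)
        λ q Ux Uy ≢ba → same (others q Ux Uy (λ { refl → true≢false Ux Ua }) ≢ba)
      ... | true | true = R.no-cut U (λ q Ux Uy → others q Ux Uy
        (λ { refl → true≢false Ub Uy }) (λ { refl → true≢false Ua Uy })) p Uu Uv
      ... | false | false = R.no-cut U (λ q Ux Uy → others q Ux Uy
        (λ { refl → true≢false Ux Ua }) (λ { refl → true≢false Ux Ub })) p Uu Uv

  -- Boundaries of the components of the dual graph.

  module BoundaryLemmas {Y} (R : DualForest Y) where

    open DualForest R

    private
      ψ = label classes

    Boundary : Dart n → Dart n → Set
    Boundary l d = IsDart d × ψ d ≡ l × ψ (swap d) ≢ l

    boundary? : ∀ l d → Dec (Boundary l d)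
    boundary? l d = isDart? d ×-dec (ψ d ≟ᴰ l ×-dec ¬? (ψ (swap d) ≟ᴰ l))

    -- Turning about `v` from `rot v u`, the spokes stay in the class until one has another class on
    -- its reverse. That spoke is the next boundary dart; it comes before `u`, since `(v , u)` is
    -- outside the class.
    boundary-next : ∀ {l u v} → Boundary l (u , v) → ∃ λ w → Boundary l (v , w) × w ≢ u
    boundary-next {l} {u} {v} (uv , in-l , out-l) =
      turn (step-dart {u , v} uv) (trans (invariant {u , v} uv) in-l)
           (cyclic v (rot v u) u (step-dart {u , v} uv) (adj-swap uv))
      where
      turn : ∀ {x} → Adj G v x → ψ (v , x) ≡ l → Star (λ x y → rot v x ≡ y) x u →
             ∃ λ w → Boundary l (v , w) × w ≢ u
      turn vx eq ε = contradiction eq out-l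
      turn {x} vx eq (refl ◅ path) with ψ (x , v) ≟ᴰ l
      ... | no ne   = x , (vx , eq , ne) , λ { refl → out-l eq }
      ... | yes eq′ = turn (closed v x vx) (trans (invariant {x , v} (adj-swap vx)) eq′) path

    -- Three successive darts of a boundary walk have distinct sources: neighbouring ones are
    -- adjacent, and the walk does not turn back, so the first differs from the third.
    boundary-triple : ∀ {l d} → Boundary l d →
                      ∃ λ ds → Unique ds × length ds ≡ 3 × (∀ {e} → e ∈ ds → Boundary l e)
    boundary-triple {l} {u , v} b₁ =
      let w , b₂ , w≢u = boundary-next b₁
          x , b₃ , _   = boundary-next b₂
      in (u , v) ∷ (v , w) ∷ (w , x) ∷ []
         , ((adj-≢ (proj₁ b₁) ∘ cong proj₁) ∷ (w≢u ∘ sym ∘ cong proj₁) ∷ [])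
           ∷ ((adj-≢ (proj₁ b₂) ∘ cong proj₁) ∷ []) ∷ [] ∷ []
         , refl
         , λ { (here refl) → b₁ ; (there (here refl)) → b₂ ; (there (there (here refl))) → b₃ }

    boundary-triples : ∀ ls → Unique ls → (∀ {l} → l ∈ ls → ∃ (Boundary l)) →
                       ∃ λ ds → Unique ds × length ds ≡ length ls * 3 ×
                       (∀ {e} → e ∈ ds → Boundary (ψ e) e × ψ e ∈ ls)
    boundary-triples [] _ _ = [] , [] , refl , λ ()
    boundary-triples (l ∷ ls) (l∉ ∷ uniq) bs =
      let ds , ds! , ds-len , ds-b = boundary-triple (proj₂ (bs (here refl)))
          es , es! , es-len , es-b = boundary-triples ls uniq (bs ∘ there)
      in ds ++ es
         , Unique.++⁺ ds! es! (λ (p , q) →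
             All.lookup l∉ (proj₂ (es-b q)) (sym (proj₁ (proj₂ (ds-b p)))))
         , trans (length-++ ds {es}) (cong₂ _+_ ds-len es-len)
         , λ e∈ → case ∈-++⁻ ds e∈ of λ
           { (inj₁ p) → let b = ds-b p ; eq = proj₁ (proj₂ b) in
               subst (λ l → Boundary l _) (sym eq) b , here eq
           ; (inj₂ p) → proj₁ (es-b p) , there (proj₂ (es-b p)) }

    -- A class without boundary is closed under reversal and face steps, hence under rotation about
    -- a vertex. Connectedness of G then carries it to every dart.
    no-boundary⇒one-class : ∀ {l} → l ∈ reps classes → ¬ ∃ (Boundary l) → length (reps classes) ≤ 1
    no-boundary⇒one-class {l@(a , b)} l∈ ¬b =
      unique-⊆⇒length-≤ _≟ᴰ_ {ys = l ∷ []} (unique classes) λ {r} r∈ → here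
        (trans (sym (fixed classes r∈))
          (spread (connected a (proj₁ r)) (around (reps-darts l∈) (fixed classes l∈)) (reps-darts r∈)))
      where
      back : ∀ {u v} → Adj G u v → ψ (u , v) ≡ l → ψ (v , u) ≡ l
      back {u} {v} p eq = decidable-stable (ψ (v , u) ≟ᴰ l) λ ne → ¬b ((u , v) , p , eq , ne)
      turn : ∀ {v x w} → Adj G v x → ψ (v , x) ≡ l → Star (λ x y → rot v x ≡ y) x w → ψ (v , w) ≡ l
      turn p eq ε = eq
      turn {v} {x} p eq (refl ◅ path) =
        turn (closed v x p) (trans (invariant {x , v} (adj-swap p)) (back p eq)) path
      around : ∀ {v x} → Adj G v x → ψ (v , x) ≡ l → ∀ {w} → Adj G v w → ψ (v , w) ≡ l
      around {v} {x} p eq {w} q = turn p eq (cyclic v x w p q)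
      spread : ∀ {u v} → Star (Adj G) u v → (∀ {w} → Adj G u w → ψ (u , w) ≡ l) →
               ∀ {w} → Adj G v w → ψ (v , w) ≡ l
      spread ε all = all
      spread (p ◅ path) all = spread path (around (adj-swap p) (back p (all p)))

  -- Bounding the number of edges inside a set of vertices.

  module _ (W : List (Fin n)) where

    Inside : Dart n → Set
    Inside (u , v) = u ∈ W × v ∈ W

    inside? : ∀ d → Dec (Inside d)
    inside? (u , v) = (u ∈? W) ×-dec (v ∈? W)

    innerEdges outerEdges : List (Dart n)
    innerEdges = filter inside? (edges G)
    outerEdges = filter (¬? ∘ inside?) (edges G)

    innerDarts-∑ : ∑ (darts G) (indicator ∘ inside?) ≡ 2 * length innerEdges
    innerDarts-∑ = trans
      (handshake (indicator ∘ inside?) λ d → indicator-⇔ (inside? (swap d)) (inside? d) swap swap)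
      (cong (2 *_) (sym (length-filter-∑ inside? (edges G))))

    module _ {w} (w∈ : w ∈ W) (W! : Unique W) where

      private
        -- G has no loops, so `(w , w)` is not a dart; it is only a default label.
        R = dualForest (w , w) outerEdges
              (λ e∈ → ∈-edges⁻ (proj₁ (∈-filter⁻ (¬? ∘ inside?) e∈)))
        open DualForest R
        open BoundaryLemmas R
        φ = length (reps classes)
        X = length innerEdges

      outer-∈ : ∀ {u v} → Adj G u v → ¬ Inside (u , v) → (u , v) ∈ outerEdges ⊎ (v , u) ∈ outerEdges
      outer-∈ p ¬i = Sum.map (λ q → ∈-filter⁺ (¬? ∘ inside?) q ¬i)
        (λ q → ∈-filter⁺ (¬? ∘ inside?) q (¬i ∘ swap)) (∈-edges⁺ p)

      -- Every edge not inside `W` was offered to the dual forest, so it has one class on both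
      -- sides.
      boundary-inside : ∀ {d} → Boundary (label classes d) d → Inside d
      boundary-inside {d} (p , _ , ne) = decidable-stable (inside? d) λ ¬i →
        case outer-∈ p ¬i of λ { (inj₁ q) → ne (sym (joined q)) ; (inj₂ q) → ne (joined q) }

      -- Either some class has no boundary and is alone, or each class has three boundary darts of
      -- its own inside `W`. The factor 2 appears because an inner edge has two darts and may bound
      -- two classes.
      classes-≤ : φ ≤ 1 ⊎ φ * 3 ≤ 2 * X
      classes-≤ with All.all? (λ l → any? λ u → any? λ v → boundary? l (u , v)) (reps classes)
      ... | no ¬all = inj₁
        (let l , l∈ , ¬b = find (¬All⇒Any¬ (λ l → any? λ u → any? λ v → boundary? l (u , v)) _ ¬all)
         in no-boundary⇒one-class l∈ λ ((u , v) , b) → ¬b (u , v , b))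
      ... | yes all = inj₂ (begin
        φ * 3                                    ≡⟨ sym len ⟩
        length ds                                ≤⟨ unique-⊆⇒length-≤ _≟ᴰ_ ds! (λ {d} → sub {d}) ⟩
        length (filter inside? (darts G))        ≡⟨ length-filter-∑ inside? (darts G) ⟩
        ∑ (darts G) (indicator ∘ inside?)        ≡⟨ innerDarts-∑ ⟩
        2 * X                                    ∎)
        where
        open ℕ.≤-Reasoning
        triples = boundary-triples (reps classes) (unique classes)
          (λ l∈ → let u , v , b = All.lookup all l∈ in (u , v) , b)
        ds = proj₁ triples
        ds! = proj₁ (proj₂ triples)
        len = proj₁ (proj₂ (proj₂ triples))
        ds-b = proj₂ (proj₂ (proj₂ triples))
        sub : ∀ {d} → d ∈ ds → d ∈ filter inside? (darts G)
        sub d∈ = let b = proj₁ (ds-b d∈) in ∈-filter⁺ inside? (∈-darts⁺ (proj₁ b)) (boundary-inside b)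

      collapse : Fin n → Fin n
      collapse v with v ∈? W
      ... | yes _ = w
      ... | no  _ = v

      collapse-∈ : ∀ {v} → v ∈ W → collapse v ≡ w
      collapse-∈ {v} v∈ with v ∈? W
      ... | yes _ = refl
      ... | no v∉ = contradiction v∈ v∉

      collapse-∉ : ∀ {v} → v ∉ W → collapse v ≡ v
      collapse-∉ {v} v∉ with v ∈? W
      ... | yes v∈ = contradiction v∈ v∉
      ... | no _ = refl

      -- The vertices of G with `W` contracted to `w`, so that edges inside `W` become loops.
      collapsed : Labelling (Fin n)
      collapsed = record
        { label  = collapse
        ; reps   = w ∷ filter (¬? ∘ (_∈? W)) (allFin n)
        ; unique = All.map (λ v∉ w≡v → v∉ (subst (_∈ W) w≡v w∈)) (all-filter (¬? ∘ (_∈? W)) (allFin n))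
                   ∷ Unique.filter⁺ _ (Unique.allFin⁺ n)
        ; fixed  = λ { (here refl) → collapse-∈ w∈
                     ; (there p) → collapse-∉ (proj₂ (∈-filter⁻ (¬? ∘ (_∈? W)) {xs = allFin n} p)) }
        }

      -- G stays connected without the forest. After the contraction of `W`, the edges of `rest`
      -- alone must therefore join the n - |W| + 1 remaining vertices into one class.
      rest-≥ : n ≤ length W + length rest
      rest-≥ with M , len , coarse , ident ← mergeAll _≟_ rest collapsed = begin
        n                             ≡⟨ sym (length-tabulate (λ i → i)) ⟩
        length (allFin n)             ≡⟨ length-filter-split (_∈? W) (allFin n) ⟩
        length (filter (_∈? W) (allFin n)) + length outside
                                      ≤⟨ ℕ.+-mono-≤ (unique-⊆⇒length-≤ _≟_ (Unique.filter⁺ _ (Unique.allFin⁺ n))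
                                           (proj₂ ∘ ∈-filter⁻ (_∈? W) {xs = allFin n}))
                                         (ℕ.≤-pred (ℕ.≤-trans len (ℕ.≤-trans (ℕ.+-monoʳ-≤ (length rest) one)
                                           (ℕ.≤-reflexive (ℕ.+-comm _ 1))))) ⟩
        length W + length rest ∎
        where
        open ℕ.≤-Reasoning
        outside = filter (¬? ∘ (_∈? W)) (allFin n)
        μ = label M
        does-true : ∀ {x y : Fin n} → does (x ≟ y) ≡ true → x ≡ y
        does-true {x} {y} eq with x ≟ y
        ... | yes p = p
        adjacent : ∀ {u v} → Adj G u v → μ u ≡ μ v
        -- Otherwise the class of `u` gives a cut that no inner edge and no edge of `rest` crosses,
        -- hence one made of forest edges only.
        adjacent {u} {v} p = decidable-stable (μ u ≟ μ v) λ ne →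
          no-cut (λ x → does (μ x ≟ μ u)) crossing p
            (dec-true (μ u ≟ μ u) refl) (dec-false (μ v ≟ μ u) (ne ∘ sym))
          where
          crossing : ∀ {x y} → Adj G x y → does (μ x ≟ μ u) ≡ true → does (μ y ≟ μ u) ≡ false →
                     (x , y) ∈ forest ⊎ (y , x) ∈ forest
          crossing {x} {y} q Ux Uy =
            case outer-∈ q (λ (x∈ , y∈) → differ (coarse (trans (collapse-∈ x∈) (sym (collapse-∈ y∈))))) of λ
              { (inj₁ e∈) → Sum.fromInj₁ (λ r → contradiction (ident r) differ) (Sum.map₁ inj₁ (covers e∈))
              ; (inj₂ e∈) → Sum.fromInj₁ (λ r → contradiction (sym (ident r)) differ) (Sum.map₁ inj₂ (covers e∈)) }
            where
            differ : μ x ≢ μ y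
            differ eq with trans (sym Uy) (dec-true (μ y ≟ μ u) (trans (sym eq) (does-true Ux)))
            ... | ()
        reach : ∀ {u v} → Star (Adj G) u v → μ u ≡ μ v
        reach ε = refl
        reach (p ◅ path) = trans (adjacent p) (reach path)
        one : length (reps M) ≤ 1
        one = unique-⊆⇒length-≤ _≟_ {ys = μ w ∷ []} (unique M)
          λ {r} r∈ → here (trans (sym (fixed M r∈)) (reach (connected r w)))

      -- Since |E| = X + |forest| + |rest|, Euler's formula and the bounds on n and on the number of
      -- faces give X + 2 ≤ |W| + φ. The two alternatives of `classes-≤` then eliminate φ.
      inner-≤ : X + 1 ≤ length W ⊎ X + 6 ≤ 3 * length W
      inner-≤ = Sum.map
        (λ φ≤1 → linear₁ core φ≤1)
        (λ 3φ≤2X → linear₂ core 3φ≤2X)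
        classes-≤
        where
        open +-*-Solver
        f = length forest
        r = length rest
        F = length (faces G rot)
        ω = length W
        core : X + 2 ≤ ω + φ
        core = ℕ.+-cancelʳ-≤ (f + r) _ _ (begin
          X + 2 + (f + r)
            ≡⟨ cong (X + 2 +_) sizes ⟩
          X + 2 + length outerEdges
            ≡⟨ solve 2 (λ x y → x :+ con 2 :+ y := x :+ y :+ con 2) refl X (length outerEdges) ⟩
          X + length outerEdges + 2
            ≡⟨ cong (_+ 2) (sym (length-filter-split inside? (edges G))) ⟩
          length (edges G) + 2
            ≡⟨ sym euler ⟩
          n + F
            ≤⟨ ℕ.+-mono-≤ rest-≥ classes-≥ ⟩
          ω + r + (f + φ)
            ≡⟨ solve 4 (λ ω r f φ → ω :+ r :+ (f :+ φ) := ω :+ φ :+ (f :+ r)) refl ω r f φ ⟩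
          ω + φ + (f + r) ∎)
          where open ℕ.≤-Reasoning
        linear₁ : X + 2 ≤ ω + φ → φ ≤ 1 → X + 1 ≤ ω
        linear₁ le φ≤1 = ℕ.+-cancelʳ-≤ 1 _ _ (ℕ.≤-trans (ℕ.≤-reflexive (ℕ.+-assoc X 1 1))
          (ℕ.≤-trans le (ℕ.+-monoʳ-≤ ω φ≤1)))
        linear₂ : X + 2 ≤ ω + φ → φ * 3 ≤ 2 * X → X + 6 ≤ 3 * ω
        linear₂ le le′ = ℕ.+-cancelʳ-≤ (2 * X) _ _ (begin
          X + 6 + 2 * X   ≡⟨ solve 1 (λ x → x :+ con 6 :+ con 2 :* x := con 3 :* (x :+ con 2)) refl X ⟩
          3 * (X + 2)     ≤⟨ ℕ.*-monoʳ-≤ 3 le ⟩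
          3 * (ω + φ)     ≡⟨ solve 2 (λ ω φ → con 3 :* (ω :+ φ) := con 3 :* ω :+ φ :* con 3) refl ω φ ⟩
          3 * ω + φ * 3   ≤⟨ ℕ.+-monoʳ-≤ (3 * ω) le′ ⟩
          3 * ω + 2 * X   ∎)
          where open ℕ.≤-Reasoning

  -- The case where `W` contains all vertices; the alternative bound n - 1 is below 3n - 6 once n ≥
  -- 3.
  edges-≤ : 3 ≤ n → length (edges G) + 6 ≤ 3 * n
  edges-≤ 3≤n = begin
    length (edges G) + 6   ≡⟨ cong (λ es → length es + 6) (sym (filter-all (inside? V) {xs = edges G} all-inside)) ⟩
    X + 6                  ≤⟨ bound (inner-≤ V (∈-allFin (fromℕ< 3≤n)) (Unique.allFin⁺ n)) ⟩
    3 * length V           ≡⟨ cong (3 *_) N≡n ⟩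
    3 * n                  ∎
    where
    open ℕ.≤-Reasoning
    V = allFin n
    N≡n : length V ≡ n
    N≡n = length-tabulate (λ i → i)
    X = length (innerEdges V)
    all-inside : All (Inside V) (edges G)
    all-inside = All.universal (λ _ → ∈-allFin _ , ∈-allFin _) (edges G)
    bound : X + 1 ≤ length V ⊎ X + 6 ≤ 3 * length V → X + 6 ≤ 3 * length V
    bound (inj₂ le) = le
    bound (inj₁ le) = begin
      X + 6                      ≡⟨ sym (ℕ.+-assoc X 1 5) ⟩
      X + 1 + 5                  ≤⟨ ℕ.+-mono-≤ le (ℕ.n≤1+n 5) ⟩
      length V + 2 * 3           ≤⟨ ℕ.+-monoʳ-≤ (length V) (ℕ.*-monoʳ-≤ 2 3≤n) ⟩
      length V + 2 * n           ≡⟨ cong (λ x → length V + 2 * x) (sym N≡n) ⟩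
      3 * length V               ∎

  -- If both faces at uv had the same third vertex x, the rotation at each of u, v, x would exchange
  -- the other two. Being cyclic, it would allow no further neighbours, and connectedness would
  -- leave only three vertices.
  opposite-distinct : 4 ≤ n → ∀ {u v} → Adj G u v → rot v u ≢ rot u v
  opposite-distinct 4≤n {u} {v} uv eq = ℕ.<⇒≱ 4≤n (subst (_≤ 3) (length-tabulate (λ i → i))
    (unique-⊆⇒length-≤ _≟_ {ys = u ∷ v ∷ x ∷ []} (Unique.allFin⁺ n) λ {z} _ → spread (connected u z) (here refl)))
    where
    x = rot v u
    vu = adj-swap uv
    xv : rot x v ≡ u
    xv = cong proj₁ (triangular u v uv)
    ux : rot u x ≡ v
    ux = trans (cong (λ z → rot z x) (sym xv)) (cong proj₂ (triangular u v uv))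
    xu : rot x u ≡ v
    xu = trans (cong (λ z → rot z u) eq) (cong proj₁ (triangular v u vu))
    vx : rot v x ≡ u
    vx = trans (cong₂ rot (sym (cong proj₁ (triangular v u vu))) eq) (cong proj₂ (triangular v u vu))
    alternate : ∀ {a b c} → rot a b ≡ c → rot a c ≡ b →
                ∀ {y z} → Star (λ x y → rot a x ≡ y) y z → y ≡ b ⊎ y ≡ c → z ≡ b ⊎ z ≡ c
    alternate p q ε i = i
    alternate p q (refl ◅ path) (inj₁ refl) = alternate p q path (inj₂ p)
    alternate p q (refl ◅ path) (inj₂ refl) = alternate p q path (inj₁ q)
    ux-adj : Adj G u x
    ux-adj = subst (Adj G u) (sym eq) (closed u v uv)
    neighbour : ∀ {y z} → y ∈ u ∷ v ∷ x ∷ [] → Adj G y z → z ∈ u ∷ v ∷ x ∷ []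
    neighbour (here refl) p with alternate (sym eq) ux (cyclic u v _ uv p) (inj₁ refl)
    ... | inj₁ refl = there (here refl)
    ... | inj₂ refl = there (there (here refl))
    neighbour (there (here refl)) p with alternate refl vx (cyclic v u _ vu p) (inj₁ refl)
    ... | inj₁ refl = here refl
    ... | inj₂ refl = there (there (here refl))
    neighbour (there (there (here refl))) p with alternate xu xv (cyclic x u _ (adj-swap ux-adj) p) (inj₁ refl)
    ... | inj₁ refl = here refl
    ... | inj₂ refl = there (here refl)
    spread : ∀ {y z} → Star (Adj G) y z → y ∈ u ∷ v ∷ x ∷ [] → z ∈ u ∷ v ∷ x ∷ []
    spread ε i = i
    spread (p ◅ path) i = spread path (neighbour i p)

  -- Crossings of a cut, counted face by face.

  module CutLemmas {H : Dart n → Set} (H? : ∀ d → Dec (H d)) (U : Fin n → Bool) where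

    Crossing : Dart n → Set
    Crossing (u , v) = H (u , v) × U u ≢ U v

    crossing? : ∀ d → Dec (Crossing d)
    crossing? (u , v) = H? (u , v) ×-dec ¬? (U u Bool.≟ U v)

    crossings : Dart n → ℕ
    crossings d = indicator (crossing? d)

    -- Faces are counted through their darts, three times each; hence the factor 3 in
    -- `faceCrossings-∑`.
    faceCrossings : Dart n → ℕ
    faceCrossings d = crossings d + crossings (step d) + crossings (step (step d))

    faceCrossings-∑ : ∑ (darts G) faceCrossings ≡ 3 * ∑ (darts G) crossings
    faceCrossings-∑ = begin
      ∑ D faceCrossings
        ≡⟨ trans (∑-+ D (λ d → crossings d + crossings (step d)) (crossings ∘ step ∘ step))
                 (cong (_+ ∑ D (crossings ∘ step ∘ step)) (∑-+ D crossings (crossings ∘ step))) ⟩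
      Z + ∑ D (crossings ∘ step) + ∑ D (crossings ∘ step ∘ step)
        ≡⟨ cong₂ (λ x y → Z + x + y) (∑-step crossings)
             (trans (∑-step (crossings ∘ step)) (∑-step crossings)) ⟩
      Z + Z + Z
        ≡⟨ trans (ℕ.+-assoc Z Z Z) (cong (λ x → Z + (Z + x)) (sym (ℕ.+-identityʳ Z))) ⟩
      3 * Z ∎
      where
      open ≡-Reasoning
      D = darts G
      Z = ∑ D crossings

    -- Two of the three vertices of a triangle lie on the same side of the cut.
    faceCrossings-≤ : ∀ {d} → IsDart d → faceCrossings d ≤ 2
    faceCrossings-≤ {u , v} p = indicators-≤2 (crossing? (u , v)) (crossing? (v , w)) (crossing? (w , rot w v))
      λ ((_ , uv) , (_ , vw) , (_ , wu)) →
        no-3-colouring (U u) (U v) (U w) uv vw (subst (λ z → U w ≢ U z) (cong proj₁ (step³ {u , v} p)) wu)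
      where
      w = rot v u
      no-3-colouring : ∀ a b c → a ≢ b → b ≢ c → c ≢ a → ⊥
      no-3-colouring true  true  _     ab _ _ = ab refl
      no-3-colouring false false _     ab _ _ = ab refl
      no-3-colouring true  false false _ bc _ = bc refl
      no-3-colouring true  false true  _ _ ca = ca refl
      no-3-colouring false true  true  _ bc _ = bc refl
      no-3-colouring false true  false _ _ ca = ca refl
      indicators-≤2 : ∀ {P Q R : Set} (P? : Dec P) (Q? : Dec Q) (R? : Dec R) → ¬ (P × Q × R) →
                      indicator P? + indicator Q? + indicator R? ≤ 2
      indicators-≤2 (yes p) (yes q) (yes r) ¬pqr = contradiction (p , q , r) ¬pqr
      indicators-≤2 (yes _) (yes _) (no _) _ = s≤s (s≤s z≤n)
      indicators-≤2 (yes _) (no _) (yes _) _ = s≤s (s≤s z≤n)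
      indicators-≤2 (yes _) (no _) (no _)  _ = s≤s z≤n
      indicators-≤2 (no _) (yes _) (yes _) _ = s≤s (s≤s z≤n)
      indicators-≤2 (no _) (yes _) (no _)  _ = s≤s z≤n
      indicators-≤2 (no _) (no _) (yes _)  _ = s≤s z≤n
      indicators-≤2 (no _) (no _) (no _)   _ = z≤n

    -- Adding up the bound 2 over all darts is strict once one face falls short of it.
    crossings-< : ∀ {d} → IsDart d → faceCrossings d ≤ 1 → 3 * ∑ (darts G) crossings < length (darts G) * 2
    crossings-< p le = subst₂ _<_ faceCrossings-∑ (∑-const (darts G) 2)
      (∑-mono-< (λ {d} → faceCrossings-≤ {d} ∘ ∈-darts⁻) (∈-darts⁺ p) (s≤s le))

    -- As uv does not cross the cut, two crossings in its face must be at both other edges; the one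
    -- at `v` is recorded.
    face-cases : ∀ {u v} → Adj G u v → U u ≡ U v →
                 faceCrossings (u , v) ≤ 1 ⊎ (H (v , rot v u) × U v ≢ U (rot v u))
    face-cases {u} {v} p eq with crossing? (v , rot v u)
    ... | yes r = inj₂ r
    ... | no _ with crossing? (u , v)
    ...   | yes (_ , ne) = contradiction eq ne
    ...   | no _ with crossing? (rot v u , rot (rot v u) v)
    ...     | yes _ = inj₁ (s≤s z≤n)
    ...     | no _ = inj₁ z≤n

-- Endpoints of a matching given as a list of edges.

endpoints : ∀ {n} → List (Dart n) → List (Fin n)
endpoints [] = []
endpoints ((u , v) ∷ ds) = u ∷ v ∷ endpoints ds

endpoints-length : ∀ {n} (ds : List (Dart n)) → length (endpoints ds) ≡ 2 * length ds
endpoints-length [] = refl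
endpoints-length (_ ∷ ds) = trans (cong (2 +_) (endpoints-length ds)) (sym (ℕ.*-suc 2 (length ds)))

-- The argument in `Fin 2` is meant as the remainder of a vertex of kK₂: vertex 2i + b goes to end b
-- of the i-th edge.
end : ∀ {n} → Fin 2 → Dart n → Fin n
end zero       (u , v) = u
end (suc zero) (u , v) = v

end-∈ : ∀ {n} b (ds : List (Dart n)) i → end b (lookup ds i) ∈ endpoints ds
end-∈ zero       (_ ∷ ds) zero    = here refl
end-∈ (suc zero) (_ ∷ ds) zero    = there (here refl)
end-∈ b          (_ ∷ ds) (suc i) = there (there (end-∈ b ds i))

end-injective : ∀ {n} (ds : List (Dart n)) → Unique (endpoints ds) → ∀ {i j b c} →
                end b (lookup ds i) ≡ end c (lookup ds j) → i ≡ j × b ≡ c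
end-injective (d ∷ ds) uniq {zero} {zero} {zero} {zero} eq = refl , refl
end-injective (d ∷ ds) uniq {zero} {zero} {suc zero} {suc zero} eq = refl , refl
end-injective (d ∷ ds) ((u≢v ∷ _) ∷ _) {zero} {zero} {zero} {suc zero} eq = contradiction eq u≢v
end-injective (d ∷ ds) ((u≢v ∷ _) ∷ _) {zero} {zero} {suc zero} {zero} eq = contradiction (sym eq) u≢v
end-injective (d ∷ ds) ((_ ∷ u∉) ∷ _) {zero} {suc j} {zero} {c} eq =
  contradiction eq (All.lookup u∉ (end-∈ c ds j))
end-injective (d ∷ ds) (_ ∷ v∉ ∷ _) {zero} {suc j} {suc zero} {c} eq =
  contradiction eq (All.lookup v∉ (end-∈ c ds j))
end-injective (d ∷ ds) ((_ ∷ u∉) ∷ _) {suc i} {zero} {b} {zero} eq =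
  contradiction (sym eq) (All.lookup u∉ (end-∈ b ds i))
end-injective (d ∷ ds) (_ ∷ v∉ ∷ _) {suc i} {zero} {b} {suc zero} eq =
  contradiction (sym eq) (All.lookup v∉ (end-∈ b ds i))
end-injective (d ∷ ds) (_ ∷ _ ∷ uniq) {suc i} {suc j} eq =
  let i≡j , b≡c = end-injective ds uniq eq in cong suc i≡j , b≡c

-- One chosen edge of each colour, and rainbow matchings.

module ColouringLemmas {n} {G : Graph n} {c colour} (χ : IsEdgeColouring G c colour) where

  open GraphLemmas G
  open IsEdgeColouring χ

  chosen : Fin c → Dart n
  chosen i = proj₁ (appears i) , proj₁ (proj₂ (appears i))

  chosen-adj : ∀ i → IsDart (chosen i)
  chosen-adj i = proj₁ (proj₂ (proj₂ (appears i)))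

  chosen-colour : ∀ i → colour (proj₁ (chosen i)) (proj₂ (chosen i)) ≡ toℕ i
  chosen-colour i = proj₂ (proj₂ (proj₂ (appears i)))

  Chosen : Dart n → Set
  Chosen d = ∃ λ i → chosen i ≡ d ⊎ chosen i ≡ swap d

  chosen? : ∀ d → Dec (Chosen d)
  chosen? d = any? λ i → (chosen i ≟ᴰ d) ⊎-dec (chosen i ≟ᴰ swap d)

  chosen-swap : ∀ {u v} → Chosen (u , v) → Chosen (v , u)
  chosen-swap (i , p) = i , Sum.swap p

  chosen⇒adj : ∀ {u v} → Chosen (u , v) → Adj G u v
  chosen⇒adj (i , inj₁ refl) = chosen-adj i
  chosen⇒adj (i , inj₂ refl) = adj-swap (chosen-adj i)

  chosen⇒colour : ∀ {u v} (h : Chosen (u , v)) → colour u v ≡ toℕ (proj₁ h)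
  chosen⇒colour (i , inj₁ refl) = chosen-colour i
  chosen⇒colour (i , inj₂ refl) = trans (symmetric _ _ (adj-swap (chosen-adj i))) (chosen-colour i)

  chosen-rainbow : ∀ {u v x y} → Chosen (u , v) → Chosen (x , y) → colour u v ≡ colour x y →
                   (u ≡ x × v ≡ y) ⊎ (u ≡ y × v ≡ x)
  chosen-rainbow h@(i , p) h′@(j , q) eq
    with refl ← toℕ-injective (trans (sym (chosen⇒colour h)) (trans eq (chosen⇒colour h′))) with p | q
  ... | inj₁ refl | inj₁ refl = inj₁ (refl , refl)
  ... | inj₁ refl | inj₂ refl = inj₂ (refl , refl)
  ... | inj₂ refl | inj₁ refl = inj₂ (refl , refl)
  ... | inj₂ refl | inj₂ refl = inj₁ (refl , refl)

  chosen-injective : ∀ {i j} → chosen i ≡ chosen j → i ≡ j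
  chosen-injective {i} {j} eq = toℕ-injective (trans (sym (chosen-colour i))
    (trans (cong (λ (u , v) → colour u v) eq) (chosen-colour j)))

  -- The chosen edges and their reverses are 2c different darts: different colours give different
  -- edges, and an edge is not its own reverse.
  colours-≤ : c + c ≤ ∑ (darts G) (indicator ∘ chosen?)
  colours-≤ = begin
    c + c                                 ≡⟨ sym (trans (length-++ (map chosen (allFin c)) {both})
                                               (cong₂ _+_ (len chosen) (len (swap ∘ chosen)))) ⟩
    length (map chosen (allFin c) ++ both) ≤⟨ unique-⊆⇒length-≤ _≟ᴰ_ uniq sub ⟩
    length (filter chosen? (darts G))     ≡⟨ length-filter-∑ chosen? (darts G) ⟩
    ∑ (darts G) (indicator ∘ chosen?)     ∎
    where
    open ℕ.≤-Reasoning
    both = map (swap ∘ chosen) (allFin c)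
    len : ∀ (f : Fin c → Dart n) → length (map f (allFin c)) ≡ c
    len f = trans (length-map f (allFin c)) (length-tabulate (λ i → i))
    in-darts : ∀ {d} → Chosen d → d ∈ filter chosen? (darts G)
    in-darts h = ∈-filter⁺ chosen? (∈-darts⁺ (chosen⇒adj h)) h
    sub : ∀ {d} → d ∈ map chosen (allFin c) ++ both → d ∈ filter chosen? (darts G)
    sub d∈ with ∈-++⁻ (map chosen (allFin c)) d∈
    ... | inj₁ p = let i , _ , eq = ∈-map⁻ chosen p in in-darts (i , inj₁ (sym eq))
    ... | inj₂ p = let i , _ , eq = ∈-map⁻ (swap ∘ chosen) p in in-darts (i , inj₂ (sym (cong swap eq)))
    uniq : Unique (map chosen (allFin c) ++ both)
    uniq = Unique.++⁺ (Unique.map⁺ chosen-injective (Unique.allFin⁺ c))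
      (Unique.map⁺ (chosen-injective ∘ cong swap) (Unique.allFin⁺ c))
      λ (p , q) → disjoint (∈-map⁻ chosen p) (∈-map⁻ (swap ∘ chosen) q)
      where
      disjoint : ∀ {d} → (∃ λ i → i ∈ allFin c × d ≡ chosen i) →
                 ¬ (∃ λ i → i ∈ allFin c × d ≡ swap (chosen i))
      disjoint (i , _ , refl) (j , _ , eq)
        with refl ← toℕ-injective {i = i} {j = j} (trans (sym (chosen⇒colour (i , inj₁ refl)))
                                                         (chosen⇒colour (j , inj₂ (sym (cong swap eq)))))
        = adj-≢ (chosen-adj i) (cong proj₁ eq)

  IsMatching : List (Dart n) → Set
  IsMatching ds = (∀ {d} → d ∈ ds → Chosen d) × Unique (endpoints ds)

  -- The colour of a chosen edge determines it up to orientation, so any matching of chosen edges is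
  -- rainbow.
  matching⇒rainbow : ∀ ds → IsMatching ds → RainbowCopy (length ds K₂) G colour
  matching⇒rainbow ds (ds-chosen , ds!) =
    record
      { vertex    = f
      ; injective = f-injective
      ; preserves = λ x y p → chosen⇒adj (f-chosen x y p)
      }
    , λ x y x′ y′ p q eq →
        Sum.map (λ (a , b) → f-injective a , f-injective b) (λ (a , b) → f-injective a , f-injective b)
          (chosen-rainbow (f-chosen x y p) (f-chosen x′ y′ q) eq)
    where
    k = length ds
    f : Fin (k * 2) → Fin n
    f x = end (remainder {k} 2 x) (lookup ds (quotient {k} 2 x))
    determined : ∀ x y → quotient {k} 2 x ≡ quotient {k} 2 y → remainder {k} 2 x ≡ remainder {k} 2 y → x ≡ y
    determined x y p q = trans (sym (combine-remQuot {k} 2 x))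
      (trans (cong₂ combine p q) (combine-remQuot {k} 2 y))
    f-injective : Injective _≡_ _≡_ f
    f-injective {x} {y} eq = let p , q = end-injective ds ds! eq in determined x y p q
    ends : ∀ b b′ i → b ≢ b′ → Chosen (end b (lookup ds i) , end b′ (lookup ds i))
    ends zero       zero       i ne = contradiction refl ne
    ends zero       (suc zero) i ne = ds-chosen (∈-lookup i)
    ends (suc zero) zero       i ne = chosen-swap (ds-chosen (∈-lookup i))
    ends (suc zero) (suc zero) i ne = contradiction refl ne
    f-chosen : ∀ x y → Adj (k K₂) x y → Chosen (f x , f y)
    f-chosen x y p =
      let same , different = Equivalence.to (T-∧ {⌊ quotient {k} 2 x ≟ quotient {k} 2 y ⌋}) p
          q = toWitness same
      in subst (λ i → Chosen (f x , end (remainder {k} 2 y) (lookup ds i))) q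
           (ends (remainder {k} 2 x) (remainder {k} 2 y) (quotient {k} 2 x)
             λ r → toWitnessFalse different (determined x y q r))

-- Extending a matching of chosen edges.

module Extension {n k c} {G : Graph n} {rot colour} (t : IsPlaneTriangulation G rot)
                 (χ : IsEdgeColouring G c colour)
                 (5≤k : 5 ≤ k) (4≤n : 4 ≤ n) (many : 2 * n + 6 * k ≤ 16 + c) where

  open GraphLemmas G
  open TriangulationLemmas t
  open ColouringLemmas χ

  separated : ∀ {v w} {W : List (Fin n)} → does (v ∈? W) ≢ does (w ∈? W) → v ∈ W → w ∉ W
  separated {v} {w} {W} ne v∈ w∈ = ne (trans (dec-true (v ∈? W) v∈) (sym (dec-true (w ∈? W) w∈)))

  module _ (ds : List (Dart n)) where

    private
      W = endpoints ds
      X = length (innerEdges W)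
      E = length (edges G)
      L = length ds
      open +-*-Solver

    open CutLemmas chosen? (λ v → does (v ∈? W))

    -- Here |W| = 2L with L ≤ k - 1, so 3|W| - 6 ≤ 6k - 12. The other alternative gives |W| - 1 ≤ 2k
    -- - 3, which is smaller because 4k ≥ 20 > 9.
    innerEdges-≤ : ∀ {w} → w ∈ W → Unique W → L < k → X + 12 ≤ 6 * k
    innerEdges-≤ w∈ W! L<k = Sum.[ case₁ , case₂ ] (inner-≤ W w∈ W!)
      where
      open ℕ.≤-Reasoning
      case₁ : X + 1 ≤ length W → X + 12 ≤ 6 * k
      case₁ le = begin
        X + 12            ≡⟨ sym (ℕ.+-assoc X 1 11) ⟩
        X + 1 + 11        ≤⟨ ℕ.+-monoˡ-≤ 11 (subst (X + 1 ≤_) (endpoints-length ds) le) ⟩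
        2 * L + 11        ≡⟨ solve 1 (λ l → con 2 :* l :+ con 11 := con 2 :* (con 1 :+ l) :+ con 9) refl L ⟩
        2 * suc L + 9     ≤⟨ ℕ.+-mono-≤ (ℕ.*-monoʳ-≤ 2 L<k) (ℕ.≤-trans (ℕ.m≤m+n 9 11) (ℕ.*-monoʳ-≤ 4 5≤k)) ⟩
        2 * k + 4 * k     ≡⟨ sym (ℕ.*-distribʳ-+ k 2 4) ⟩
        6 * k             ∎
      case₂ : X + 6 ≤ 3 * length W → X + 12 ≤ 6 * k
      case₂ le = begin
        X + 12            ≡⟨ sym (ℕ.+-assoc X 6 6) ⟩
        X + 6 + 6         ≤⟨ ℕ.+-monoˡ-≤ 6 (subst (λ w → X + 6 ≤ 3 * w) (endpoints-length ds) le) ⟩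
        3 * (2 * L) + 6   ≡⟨ solve 1 (λ l → con 3 :* (con 2 :* l) :+ con 6 := con 6 :* (con 1 :+ l)) refl L ⟩
        6 * suc L         ≤⟨ ℕ.*-monoʳ-≤ 6 L<k ⟩
        6 * k             ∎

    -- Counting darts, 2c ≤ 2X + Z, and 3Z < 4E because one face is unsaturated; together 6c < 6X +
    -- 4E. With X ≤ 6k - 12 and E ≤ 3n - 6 the right side is at most 6(2n + 6k - 16), hence at most
    -- 6c. The constant 96 is 6 · 16.
    unsaturated-face⇒⊥ : ∀ {w} → w ∈ W → Unique W → L < k →
                         (∀ {u v} → Chosen (u , v) → u ∈ W ⊎ v ∈ W) →
                         ∀ {d} → IsDart d → ¬ faceCrossings d ≤ 1
    unsaturated-face⇒⊥ w∈ W! L<k covered {d} d-dart le = ℕ.<-irrefl refl (begin-strict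
      6 * (16 + c)
        ≡⟨ solve 1 (λ c → con 6 :* (con 16 :+ c) := con 96 :+ con 3 :* (c :+ c)) refl c ⟩
      96 + 3 * (c + c)
        ≤⟨ ℕ.+-monoʳ-≤ 96 (ℕ.*-monoʳ-≤ 3 count) ⟩
      96 + 3 * (2 * X + Z)
        ≡⟨ solve 2 (λ x z → con 96 :+ con 3 :* (con 2 :* x :+ z) := con 96 :+ con 6 :* x :+ con 3 :* z)
             refl X Z ⟩
      96 + 6 * X + 3 * Z
        <⟨ ℕ.+-monoʳ-< (96 + 6 * X) (crossings-< {d} d-dart le) ⟩
      96 + 6 * X + length (darts G) * 2
        ≡⟨ cong (λ x → 96 + 6 * X + x * 2) {x = length (darts G)} {y = 2 * E} darts≡2E ⟩
      96 + 6 * X + 2 * E * 2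
        ≡⟨ solve 2 (λ x e → con 96 :+ con 6 :* x :+ con 2 :* e :* con 2 :=
                            con 6 :* (x :+ con 12) :+ con 4 :* (e :+ con 6)) refl X E ⟩
      6 * (X + 12) + 4 * (E + 6)
        ≤⟨ ℕ.+-mono-≤ (ℕ.*-monoʳ-≤ 6 (innerEdges-≤ w∈ W! L<k))
                      (ℕ.*-monoʳ-≤ 4 (edges-≤ (ℕ.≤-trans (ℕ.n≤1+n 3) 4≤n))) ⟩
      6 * (6 * k) + 4 * (3 * n)
        ≡⟨ solve 2 (λ k n → con 6 :* (con 6 :* k) :+ con 4 :* (con 3 :* n) :=
                            con 6 :* (con 2 :* n :+ con 6 :* k)) refl k n ⟩
      6 * (2 * n + 6 * k)
        ≤⟨ ℕ.*-monoʳ-≤ 6 many ⟩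
      6 * (16 + c) ∎)
      where
      open ℕ.≤-Reasoning
      Z = ∑ (darts G) crossings
      darts≡2E : length (darts G) ≡ 2 * E
      darts≡2E = trans (sym (trans (∑-const (darts G) 1) (ℕ.*-identityʳ _)))
        (trans (handshake (λ _ → 1) (λ _ → refl))
               (cong (2 *_) {y = E} (trans (∑-const (edges G) 1) (ℕ.*-identityʳ E))))
      inside-or-crossing : ∀ d → Chosen d → Inside W d ⊎ Crossing d
      inside-or-crossing (u , v) h with u ∈? W | v ∈? W | covered h
      ... | yes u∈ | yes v∈ | _       = inj₁ (u∈ , v∈)
      ... | yes _  | no _   | _       = inj₂ (h , λ ())
      ... | no _   | yes _  | _       = inj₂ (h , λ ())
      ... | no u∉  | no _   | inj₁ u∈ = contradiction u∈ u∉
      ... | no _   | no v∉  | inj₂ v∈ = contradiction v∈ v∉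
      count : c + c ≤ 2 * X + Z
      count = begin
        c + c
          ≤⟨ colours-≤ ⟩
        ∑ (darts G) (indicator ∘ chosen?)
          ≤⟨ ∑-mono (darts G) (λ {d} _ → indicator-⊎ (chosen? d) (inside? W d) (crossing? d) (inside-or-crossing d)) ⟩
        ∑ (darts G) (λ d → indicator (inside? W d) + crossings d)
          ≡⟨ ∑-+ (darts G) (indicator ∘ inside? W) crossings ⟩
        ∑ (darts G) (indicator ∘ inside? W) + Z
          ≡⟨ cong (_+ Z) (innerDarts-∑ W) ⟩
        2 * X + Z ∎

    saturated-face : ∀ {u v} → Unique W → L < k → (∀ {u v} → Chosen (u , v) → u ∈ W ⊎ v ∈ W) →
                     Adj G u v → u ∈ W → v ∈ W → Chosen (v , rot v u) × rot v u ∉ W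
    saturated-face {u} {v} W! L<k covered uv u∈ v∈ =
      Sum.[ (λ le → contradiction le (unsaturated-face⇒⊥ u∈ W! L<k covered {u , v} uv))
          , (λ (h , sep) → h , separated sep v∈) ]
        (face-cases uv (trans (dec-true (u ∈? W) u∈) (sym (dec-true (v ∈? W) v∈))))

  -- Provides the first edge of the matching: 6k ≥ 30 > 16 forces c ≥ 1.
  some-colour : Fin c
  some-colour = fromℕ< (ℕ.+-cancelˡ-≤ 16 1 c (begin
    17              ≤⟨ ℕ.m≤m+n 17 13 ⟩
    6 * 5           ≤⟨ ℕ.*-monoʳ-≤ 6 5≤k ⟩
    6 * k           ≤⟨ ℕ.m≤n+m (6 * k) (2 * n) ⟩
    2 * n + 6 * k   ≤⟨ many ⟩
    16 + c          ∎))
    where open ℕ.≤-Reasoning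

  -- The two darts of uv give the third vertices x = `rot v u` and y = `rot u v` of its faces. They
  -- lie outside the matching and differ by `opposite-distinct`, so x, v, u, y is an augmenting
  -- path.
  augment : ∀ {u v ds} → IsMatching ((u , v) ∷ ds) → suc (length ds) < k →
            (∀ {a b} → Chosen (a , b) → a ∈ u ∷ v ∷ endpoints ds ⊎ b ∈ u ∷ v ∷ endpoints ds) →
            IsMatching ((v , rot v u) ∷ (u , rot u v) ∷ ds)
  augment {u} {v} {ds} (ds-chosen , ds!@((u≢v ∷ u∉) ∷ v∉ ∷ uniq)) L<k covered =
    (λ { (here refl) → vx ; (there (here refl)) → uy ; (there (there p)) → ds-chosen (there p) })
    , (x∉ ∘ there ∘ here ∘ sym ∷ u≢v ∘ sym ∷ y∉ ∘ there ∘ here ∘ sym ∷ v∉)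
      ∷ (x∉ ∘ here ∷ opposite-distinct 4≤n uv ∷ ¬Any⇒All¬ _ (x∉ ∘ there ∘ there))
      ∷ (y∉ ∘ here ∘ sym ∷ u∉)
      ∷ ¬Any⇒All¬ _ (y∉ ∘ there ∘ there)
      ∷ uniq
    where
    uv : Adj G u v
    uv = chosen⇒adj (ds-chosen (here refl))
    face-uv : Chosen (v , rot v u) × rot v u ∉ u ∷ v ∷ endpoints ds
    face-uv = saturated-face ((u , v) ∷ ds) ds! L<k covered uv (here refl) (there (here refl))
    face-vu : Chosen (u , rot u v) × rot u v ∉ u ∷ v ∷ endpoints ds
    face-vu = saturated-face ((u , v) ∷ ds) ds! L<k covered (adj-swap uv) (there (here refl)) (here refl)
    vx = proj₁ face-uv
    x∉ = proj₂ face-uv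
    uy = proj₁ face-vu
    y∉ = proj₂ face-vu

  extend : ∀ ds → IsMatching ds → length ds < k → ∃ λ ds′ → IsMatching ds′ × length ds′ ≡ suc (length ds)
  extend ds M@(ds-chosen , ds!) L<k
    with any? (λ u → any? λ v → chosen? (u , v) ×-dec (¬? (u ∈? endpoints ds) ×-dec ¬? (v ∈? endpoints ds)))
  ... | yes (u , v , h , u∉ , v∉) =
    (u , v) ∷ ds
    , ( (λ { (here refl) → h ; (there p) → ds-chosen p })
      , (adj-≢ (chosen⇒adj h) ∷ ¬Any⇒All¬ _ u∉) ∷ ¬Any⇒All¬ _ v∉ ∷ ds!)
    , refl
  extend [] _ _ | no ¬free =
    -- The empty matching meets no edge, so any chosen edge is free.
    contradiction (_ , _ , (some-colour , inj₁ refl) , (λ ()) , (λ ())) ¬free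
  extend ((u , v) ∷ ds) M L<k | no ¬free = _ , augment M L<k covered , refl
    where
    covered : ∀ {a b} → Chosen (a , b) → a ∈ u ∷ v ∷ endpoints ds ⊎ b ∈ u ∷ v ∷ endpoints ds
    covered {a} {b} h with a ∈? (u ∷ v ∷ endpoints ds) | b ∈? (u ∷ v ∷ endpoints ds)
    ... | yes a∈ | _      = inj₁ a∈
    ... | no _   | yes b∈ = inj₂ b∈
    ... | no a∉  | no b∉  = contradiction (a , b , h , a∉ , b∉) ¬free

  matching : ∀ j → j ≤ k → ∃ λ ds → IsMatching ds × length ds ≡ j
  matching zero    _ = [] , ((λ ()) , []) , refl
  matching (suc j) j<k with matching j (ℕ.<⇒≤ j<k)
  ... | ds , M , refl = extend ds M j<k

theorem1p2 : (k n : ℕ) → 5 ≤ k → 2 * k ≤ n → rb n (k K₂) ≤ 2 * n + 6 * k ∸ 16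
-- By minimality of `rb`, it suffices that this many colours force a rainbow copy.
theorem1p2 k n 5≤k 2k≤n = proj₂ (rb-isRainbowNumber n (k K₂)) _ forces
  where
  forces : Forces n (k K₂) (2 * n + 6 * k ∸ 16)
  forces G (rot , t) _ c m≤c colour χ
    with ds , M , refl ← Extension.matching t χ 5≤k
           -- Here n ≥ 2k ≥ 10, which gives n ≥ 4.
           (ℕ.≤-trans (ℕ.≤-trans (ℕ.m≤m+n 4 6) (ℕ.*-monoʳ-≤ 2 5≤k)) 2k≤n)
           -- The lower bound on c becomes 2n + 6k ≤ 16 + c, free of truncated subtraction.
           (ℕ.≤-trans (ℕ.m≤n+m∸n _ 16) (ℕ.+-monoʳ-≤ 16 m≤c)) k ℕ.≤-refl
    = ColouringLemmas.matching⇒rainbow χ ds M
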